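{- The nine graphs $\mathrm{NC}^0_{60},\dots,\mathrm{NC}^6_{60}$, $\mathrm{NC}^7_{84}$, $\mathrm{NC}^8_{84}$ defined below are pairwise non-isomorphic, connected, cubic, vertex-transitive, non-symmetric, non-Cayley graphs, and each has a non-solvable full automorphism group.
   Context: For a finite group $G$, a subgroup $H$ and a union $D$ of double cosets of $H$ with $D^{ -1}=D$, the coset graph $\mathrm{Cos}(G,H,D)$ has vertex set the right cosets of $H$ in $G$ and edges $\{Hg,Hdg\}$ for $g\in G$, $d\in D$. A graph is vertex-transitive if its automorphism group is transitive on vertices, symmetric if it is transitive on arcs, and Cayley if its automorphism group contains a subgroup acting regularly on the vertices; a VNC-graph is a vertex-transitive non-Cayley graph. Permutations are written in cycle notation and composed left to right. Define $\mathrm{NC}^i_{12p}=\mathrm{Cos}(G,H,HaH\cup HbH)$ with the following data, where $S_5$, $A_5$ act on $\{1,\dots,5\}$, and $A_5\times\mathbb{Z}_2$, $S_5\times\mathbb{Z}_2$ denote $A_5\times\langle(6\,7)\rangle$, $S_5\times\langle(6\,7)\rangle\le S_7$: $\mathrm{NC}^0_{60}$: $G=S_5$, $H=\langle(1\,3)(2\,5)\rangle$, $a=(1\,2\,4\,5\,3)$, $b=(2\,5)$. $\mathrm{NC}^1_{60}$: $G=A_5\times\mathbb{Z}_2$, $H=\langle(2\,3)(4\,5)\rangle$, $a=(2\,5)(3\,4)(6\,7)$, $b=(1\,2)(3\,4)(6\,7)$. $\mathrm{NC}^2_{60}$: $G=A_5\times\mathbb{Z}_2$, $H=\langle(2\,3)(4\,5)\rangle$,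 $a=(1\,2\,4\,5\,3)$, $b=(2\,4)(3\,5)(6\,7)$. $\mathrm{NC}^3_{60}$: $G=A_5\times\mathbb{Z}_2$, $H=\langle(2\,3)(4\,5)\rangle$, $a=(1\,3\,5\,4\,2)(6\,7)$, $b=(2\,4)(3\,5)$. $\mathrm{NC}^4_{60}$: $G=S_5\times\mathbb{Z}_2$, $H=\langle(1\,3),(4\,5)\rangle$, $a=(1\,3\,2)(4\,5)$, $b=(1\,5\,3\,4)(6\,7)$. $\mathrm{NC}^5_{60}$: $G=S_5\times\mathbb{Z}_2$, $H=\langle(1\,3)(6\,7),(4\,5)(6\,7)\rangle$, $a=(2\,5)$, $b=(1\,4\,3\,5)(6\,7)$. $\mathrm{NC}^6_{60}$: $G=S_5\times\mathbb{Z}_2$, $H=\langle(1\,3)(6\,7),(4\,5)(6\,7)\rangle$, $a=(2\,4)$, $b=(1\,4)(3\,5)(6\,7)$. $\mathrm{NC}^7_{84}$: $H=\langle(1\,7)(2\,4)(3\,8),(1\,4)(2\,7)(5\,6)\rangle$, $a=(1\,8\,4)(2\,7\,3)$, $b=(1\,4\,2\,7)(3\,6\,8\,5)$, and $G=\langle H,a,b\rangle\le S_8$, a group isomorphic to $\mathrm{PGL}(2,7)$. $\mathrm{NC}^8_{84}$: $H=\langle(1\,6)(2\,4)(3\,7)(5\,8),(1\,4)(2\,6)(3\,8)(5\,7)\rangle$, $a=(1\,3\,5\,2\,6\,7\,8\,4)$, $b=(1\,5\,2\,3)(4\,8\,6\,7)$, and $G=\langle H,a,b\rangle\le S_8$,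 a group isomorphic to $\mathrm{PGL}(2,7)$. -}

module Defs where

open import Data.Nat using (ℕ; zero; suc; _∸_; _<?_; _<_; _+_)
import Data.Nat as N
open import Data.Fin using (Fin; toℕ; fromℕ<; #_) renaming (_<?_ to _F<?_)
open import Data.Fin.Properties using (all?; _≟_)
open import Data.Fin.Permutation as P using (Permutation′; permutation; _⟨$⟩ʳ_; _⟨$⟩ˡ_)
open import Data.Vec using (Vec; lookup) renaming (_∷_ to _∷ᵥ_; [] to []ᵥ)
open import Data.List using (List; []; _∷_; map; reverse; length; filter; allFin; cartesianProduct)
open import Data.List.Membership.Propositional using (_∈_)
open import Data.Maybe using (Maybe; just; nothing)
open import Data.Bool using (if_then_else_)
open import Data.Product using (Σ; ∃; _×_; _,_; proj₁; proj₂)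
open import Data.Sum using (_⊎_)
open import Data.Unit using (⊤)
open import Data.Empty using (⊥)
open import Relation.Nullary using (¬_; yes; no; Dec)
open import Relation.Nullary.Decidable using (True; toWitness; ⌊_⌋)
open import Relation.Binary.PropositionalEquality using (_≡_; _≢_)

-- Permutations of {1,…,n} (points are Fin n; point k of the paper is
-- the element of Fin n with toℕ = k - 1).

Perm : ℕ → Set
Perm n = Permutation′ n

-- Product written left to right, as in the paper: (p · q) applies p first.
infixl 7 _·_
_·_ : ∀ {n} → Perm n → Perm n → Perm n
p · q = p P.∘ₚ q

_⁻¹ : ∀ {n} → Perm n → Perm n
p ⁻¹ = P.flip p

idP : ∀ {n} → Perm n
idP = P.id

infix 4 _≈ₚ_
_≈ₚ_ : ∀ {n} → Perm n → Perm n → Set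
p ≈ₚ q = ∀ i → p ⟨$⟩ʳ i ≡ q ⟨$⟩ʳ i

-- Cycle notation.  A permutation is given as a list of disjoint cycles,
-- each a list of points in {1,…,n}.

private
  cycImg : ℕ → List ℕ → ℕ → Maybe ℕ
  cycImg y₀ []           x = nothing
  cycImg y₀ (y ∷ [])     x = if ⌊ y N.≟ x ⌋ then just y₀ else nothing
  cycImg y₀ (y ∷ z ∷ ys) x = if ⌊ y N.≟ x ⌋ then just z else cycImg y₀ (z ∷ ys) x

  img : List (List ℕ) → ℕ → Maybe ℕ
  img []              x = nothing
  img ([] ∷ cs)       x = img cs x
  img ((y ∷ ys) ∷ cs) x with cycImg y (y ∷ ys) x
  ... | just z  = just z
  ... | nothing = img cs x

  toFinOr : ∀ {n} → ℕ → Fin n → Fin n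
  toFinOr {n} m d with m <? n
  ... | yes p = fromℕ< p
  ... | no _  = d

cycFun : ∀ {n} → List (List ℕ) → Fin n → Fin n
cycFun cs i with img cs (suc (toℕ i))
... | just y  = toFinOr (y ∸ 1) i
... | nothing = i

-- the permutation with the given cycle decomposition; the implicit
-- arguments are decidable checks that the data really is a permutation
-- (they are discharged automatically by computation)
cyc : ∀ {n} (cs : List (List ℕ))
      {p : True (all? (λ (i : Fin n) → cycFun cs (cycFun (map reverse cs) i) ≟ i))}
      {q : True (all? (λ (i : Fin n) → cycFun (map reverse cs) (cycFun cs i) ≟ i))} →
      Perm n
cyc cs {p} {q} = permutation (cycFun cs) (cycFun (map reverse cs))
                   (toWitness p) (toWitness q)

data ⟨_⟩ {n} (S : List (Perm n)) : Perm n → Set where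
  gen : ∀ {p q} → q ∈ S → p ≈ₚ q → ⟨ S ⟩ p
  one : ∀ {p} → p ≈ₚ idP → ⟨ S ⟩ p
  mul : ∀ {p q r} → ⟨ S ⟩ p → ⟨ S ⟩ q → r ≈ₚ p · q → ⟨ S ⟩ r
  inv : ∀ {p r} → ⟨ S ⟩ p → r ≈ₚ p ⁻¹ → ⟨ S ⟩ r

-- internal product A B = { a b : a ∈ A, b ∈ B } (a direct product when
-- A, B commute elementwise and intersect trivially)
_⊗_ : ∀ {n} → (Perm n → Set) → (Perm n → Set) → Perm n → Set
(A ⊗ B) p = Σ _ λ x → Σ _ λ y → A x × B y × p ≈ₚ x · y

Sym : ∀ n → Perm n → Set
Sym n p = ⊤

inversions : ∀ {n} → Perm n → ℕ
inversions {n} p =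
  length (filter (λ ij → p ⟨$⟩ʳ proj₂ ij F<? p ⟨$⟩ʳ proj₁ ij)
                 (filter (λ ij → proj₁ ij F<? proj₂ ij)
                         (cartesianProduct (allFin n) (allFin n))))

isEven : ℕ → Set
isEven m = Σ ℕ λ k → m ≡ k + k

Even : ∀ {n} → Perm n → Set
Even p = isEven (inversions p)

-- Graphs with a setoid of vertices (needed for coset graphs, whose
-- vertices are right cosets, i.e. group elements up to an equivalence).

record Graph : Set₁ where
  field
    V   : Set
    _≃_ : V → V → Set
    E   : V → V → Set

module _ {n : ℕ} (G H : Perm n → Set) where

  DC : Perm n → Perm n → Set
  DC x z = Σ _ λ h₁ → Σ _ λ h₂ → H h₁ × H h₂ × z ≈ₚ h₁ · x · h₂

  SameCoset : Perm n → Perm n → Set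
  SameCoset x y = H (x · y ⁻¹)

  Cos : Perm n → Perm n → Graph
  Cos a b = record
    { V   = Σ (Perm n) G
    ; _≃_ = λ u v → SameCoset (proj₁ u) (proj₁ v)
    ; E   = λ u v → Σ (Perm n) λ g → G g × Σ (Perm n) λ d → (DC a d ⊎ DC b d) ×
              ((SameCoset (proj₁ u) g × SameCoset (proj₁ v) (d · g)) ⊎
               (SameCoset (proj₁ u) (d · g) × SameCoset (proj₁ v) g))
    }

record Iso (Γ Δ : Graph) : Set where
  private
    module Γ = Graph Γ
    module Δ = Graph Δ
  field
    to      : Γ.V → Δ.V
    from    : Δ.V → Γ.V
    to-cong   : ∀ {u v} → u Γ.≃ v → to u Δ.≃ to v
    from-cong : ∀ {u v} → u Δ.≃ v → from u Γ.≃ from v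
    to-from : ∀ v → to (from v) Δ.≃ v
    from-to : ∀ v → from (to v) Γ.≃ v
    hom     : ∀ u v → Γ.E u v → Δ.E (to u) (to v)
    hom⁻    : ∀ u v → Δ.E (to u) (to v) → Γ.E u v

Aut : Graph → Set
Aut Γ = Iso Γ Γ

module _ (Γ : Graph) where
  open Graph Γ
  open Iso

  data Walk : V → V → Set where
    stop : ∀ {u v} → u ≃ v → Walk u v
    step : ∀ {u w v} → E u w → Walk w v → Walk u v

  Connected : Set
  Connected = ∀ u v → Walk u v

  Cubic : Set
  Cubic = ∀ v → Σ V λ x → Σ V λ y → Σ V λ z →
            E v x × E v y × E v z ×
            ¬ (x ≃ y) × ¬ (x ≃ z) × ¬ (y ≃ z) ×
            (∀ w → E v w → w ≃ x ⊎ w ≃ y ⊎ w ≃ z)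

  VertexTransitive : Set
  VertexTransitive = ∀ u v → Σ (Aut Γ) λ φ → to φ u ≃ v

  Symmetric : Set
  Symmetric = ∀ u v u′ v′ → E u v → E u′ v′ →
              Σ (Aut Γ) λ φ → to φ u ≃ u′ × to φ v ≃ v′

  _≐_ : Aut Γ → Aut Γ → Set
  φ ≐ ψ = ∀ v → to φ v ≃ to ψ v

  IsSubgroup : (Aut Γ → Set) → Set
  IsSubgroup R =
    (Σ (Aut Γ) λ ε → R ε × (∀ v → to ε v ≃ v)) ×
    (∀ φ ψ → R φ → R ψ → Σ (Aut Γ) λ χ → R χ × (∀ v → to χ v ≃ to ψ (to φ v))) ×
    (∀ φ → R φ → Σ (Aut Γ) λ χ → R χ × (∀ v → to χ v ≃ from φ v))

  Regular : (Aut Γ → Set) → Set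
  Regular R = ∀ u v → Σ (Aut Γ) λ φ → R φ × to φ u ≃ v ×
                (∀ ψ → R ψ → to ψ u ≃ v → ψ ≐ φ)

  Cayley : Set₁
  Cayley = Σ (Aut Γ → Set) λ R → IsSubgroup R × Regular R

  -- Aut Γ is solvable: there is a series
  --   Aut Γ = S 0 ≥ S 1 ≥ … ≥ S k = 1
  -- of subgroups, each normal in the previous one with abelian quotient
  -- (i.e. containing all commutators of the previous one).
  SolvableAut : Set₁
  SolvableAut = Σ ℕ λ k → Σ (ℕ → Aut Γ → Set) λ S →
    (∀ φ → S 0 φ) ×
    (∀ i → IsSubgroup (S i)) ×
    (∀ i φ → S (suc i) φ → S i φ) ×
    (∀ i φ ψ → S i φ → S (suc i) ψ → ∀ χ →
       (∀ v → to χ v ≃ from φ (to ψ (to φ v))) → S (suc i) χ) ×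
    (∀ i φ ψ → S i φ → S i ψ → ∀ χ →
       (∀ v → to χ v ≃ to ψ (to φ (from ψ (from φ v)))) → S (suc i) χ) ×
    (∀ φ → S k φ → ∀ v → to φ v ≃ v)

S₅⁽⁷⁾ : Perm 7 → Set
S₅⁽⁷⁾ p = p ⟨$⟩ʳ (# 5) ≡ # 5 × p ⟨$⟩ʳ (# 6) ≡ # 6

A₅⁽⁷⁾ : Perm 7 → Set
A₅⁽⁷⁾ p = S₅⁽⁷⁾ p × Even p

t67 : Perm 7
t67 = cyc ((6 ∷ 7 ∷ []) ∷ [])

A₅×Z₂ : Perm 7 → Set
A₅×Z₂ = A₅⁽⁷⁾ ⊗ ⟨ t67 ∷ [] ⟩

S₅×Z₂ : Perm 7 → Set
S₅×Z₂ = S₅⁽⁷⁾ ⊗ ⟨ t67 ∷ [] ⟩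

NC0-60 : Graph
NC0-60 = Cos (Sym 5) ⟨ cyc ((1 ∷ 3 ∷ []) ∷ (2 ∷ 5 ∷ []) ∷ []) ∷ [] ⟩
  (cyc ((1 ∷ 2 ∷ 4 ∷ 5 ∷ 3 ∷ []) ∷ []))
  (cyc ((2 ∷ 5 ∷ []) ∷ []))

H₁₂₃ : Perm 7 → Set
H₁₂₃ = ⟨ cyc ((2 ∷ 3 ∷ []) ∷ (4 ∷ 5 ∷ []) ∷ []) ∷ [] ⟩

NC1-60 : Graph
NC1-60 = Cos A₅×Z₂ H₁₂₃
  (cyc ((2 ∷ 5 ∷ []) ∷ (3 ∷ 4 ∷ []) ∷ (6 ∷ 7 ∷ []) ∷ []))
  (cyc ((1 ∷ 2 ∷ []) ∷ (3 ∷ 4 ∷ []) ∷ (6 ∷ 7 ∷ []) ∷ []))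

NC2-60 : Graph
NC2-60 = Cos A₅×Z₂ H₁₂₃
  (cyc ((1 ∷ 2 ∷ 4 ∷ 5 ∷ 3 ∷ []) ∷ []))
  (cyc ((2 ∷ 4 ∷ []) ∷ (3 ∷ 5 ∷ []) ∷ (6 ∷ 7 ∷ []) ∷ []))

NC3-60 : Graph
NC3-60 = Cos A₅×Z₂ H₁₂₃
  (cyc ((1 ∷ 3 ∷ 5 ∷ 4 ∷ 2 ∷ []) ∷ (6 ∷ 7 ∷ []) ∷ []))
  (cyc ((2 ∷ 4 ∷ []) ∷ (3 ∷ 5 ∷ []) ∷ []))

NC4-60 : Graph
NC4-60 = Cos S₅×Z₂
  ⟨ cyc ((1 ∷ 3 ∷ []) ∷ []) ∷ cyc ((4 ∷ 5 ∷ []) ∷ []) ∷ [] ⟩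
  (cyc ((1 ∷ 3 ∷ 2 ∷ []) ∷ (4 ∷ 5 ∷ []) ∷ []))
  (cyc ((1 ∷ 5 ∷ 3 ∷ 4 ∷ []) ∷ (6 ∷ 7 ∷ []) ∷ []))

H₅₆ : Perm 7 → Set
H₅₆ = ⟨ cyc ((1 ∷ 3 ∷ []) ∷ (6 ∷ 7 ∷ []) ∷ []) ∷
        cyc ((4 ∷ 5 ∷ []) ∷ (6 ∷ 7 ∷ []) ∷ []) ∷ [] ⟩

NC5-60 : Graph
NC5-60 = Cos S₅×Z₂ H₅₆
  (cyc ((2 ∷ 5 ∷ []) ∷ []))
  (cyc ((1 ∷ 4 ∷ 3 ∷ 5 ∷ []) ∷ (6 ∷ 7 ∷ []) ∷ []))

NC6-60 : Graph
NC6-60 = Cos S₅×Z₂ H₅₆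
  (cyc ((2 ∷ 4 ∷ []) ∷ []))
  (cyc ((1 ∷ 4 ∷ []) ∷ (3 ∷ 5 ∷ []) ∷ (6 ∷ 7 ∷ []) ∷ []))

module _ (h₁ h₂ a b : Perm 8) where
  CosGen : Graph
  CosGen = Cos ⟨ h₁ ∷ h₂ ∷ a ∷ b ∷ [] ⟩ ⟨ h₁ ∷ h₂ ∷ [] ⟩ a b

NC7-84 : Graph
NC7-84 = CosGen
  (cyc ((1 ∷ 7 ∷ []) ∷ (2 ∷ 4 ∷ []) ∷ (3 ∷ 8 ∷ []) ∷ []))
  (cyc ((1 ∷ 4 ∷ []) ∷ (2 ∷ 7 ∷ []) ∷ (5 ∷ 6 ∷ []) ∷ []))
  (cyc ((1 ∷ 8 ∷ 4 ∷ []) ∷ (2 ∷ 7 ∷ 3 ∷ []) ∷ []))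
  (cyc ((1 ∷ 4 ∷ 2 ∷ 7 ∷ []) ∷ (3 ∷ 6 ∷ 8 ∷ 5 ∷ []) ∷ []))

NC8-84 : Graph
NC8-84 = CosGen
  (cyc ((1 ∷ 6 ∷ []) ∷ (2 ∷ 4 ∷ []) ∷ (3 ∷ 7 ∷ []) ∷ (5 ∷ 8 ∷ []) ∷ []))
  (cyc ((1 ∷ 4 ∷ []) ∷ (2 ∷ 6 ∷ []) ∷ (3 ∷ 8 ∷ []) ∷ (5 ∷ 7 ∷ []) ∷ []))
  (cyc ((1 ∷ 3 ∷ 5 ∷ 2 ∷ 6 ∷ 7 ∷ 8 ∷ 4 ∷ []) ∷ []))
  (cyc ((1 ∷ 5 ∷ 2 ∷ 3 ∷ []) ∷ (4 ∷ 8 ∷ 6 ∷ 7 ∷ []) ∷ []))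

NC : Fin 9 → Graph
NC i = lookup (NC0-60 ∷ᵥ NC1-60 ∷ᵥ NC2-60 ∷ᵥ NC3-60 ∷ᵥ NC4-60 ∷ᵥ
               NC5-60 ∷ᵥ NC6-60 ∷ᵥ NC7-84 ∷ᵥ NC8-84 ∷ᵥ []ᵥ) i

-- Each coset graph is identified with an explicit cubic graph on {0,…,59} or {0,…,83}.  Right
-- translations by the group are automorphisms, transitive on vertices.  A backtracking search
-- bounds all other maps: it finds no embedding between two different graphs; no automorphism
-- that fixes vertex 0 and takes one particular neighbour of it to another; and for a suitable
-- vertex c only automorphisms taking 0 to c of which some power has a fixed point without being
-- trivial, so that none of them lies in a regular subgroup.  Finally each group contains five
-- elements, each a commutator of two of the five, so that a subnormal series with abelian
-- factors never loses their translations.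

{-# OPTIONS --safe #-}
module Submission where

open import Defs
open import Data.Bool using (true)
open import Data.Nat using (ℕ; zero; suc; _+_; _∸_; _<_; s≤s; _<?_; _≟_; ⌊_/2⌋)
open import Data.Nat.Properties
  using (<-trans; m≤n+m; +-suc; <⇒≢; m<1+n⇒m<n∨m≡n; n∸n≡0; +-∸-assoc; n≡⌊n+n/2⌋; m+[n∸m]≡n;
         +-comm)
open import Data.Nat.Induction using (<-rec)
open import Data.Fin using (Fin; zero; suc; #_; _↑ˡ_) renaming (_<_ to _F<_; _<?_ to _F<?_)
import Data.Fin.Properties as F
open import Data.Fin.Permutation using (_⟨$⟩ʳ_; _⟨$⟩ˡ_; inverseˡ; inverseʳ)
open import Data.List
  using (List; []; _∷_; map; filter; length; concatMap; upTo; downFrom; allFin;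
         cartesianProduct; cartesianProductWith)
  renaming (_++_ to _++ˡ_)
open import Data.List.Properties using (filter-≐)
open import Data.List.Membership.Propositional using (_∈_; _∉_; find; lose)
open import Data.List.Membership.Propositional.Properties
  using (∈-filter⁺; ∈-filter⁻; ∈-map⁺; ∈-map⁻; ∈-concatMap⁺; ∈-upTo⁺; ∈-upTo⁻; ∈-downFrom⁻;
         ∈-allFin; ∈-++⁺ˡ; ∈-++⁺ʳ; ∈-++⁻; ∈-cartesianProductWith⁻)
import Data.List.Membership.DecPropositional as DecMembership
open import Data.List.Relation.Unary.All using (All; []; _∷_)
import Data.List.Relation.Unary.All as All
import Data.List.Relation.Unary.All.Properties as All
open import Data.List.Relation.Unary.Any using (Any; here; there; any?)
import Data.List.Relation.Unary.Any as Any
open import Data.Vec using (Vec; lookup; tabulate)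
  renaming ([] to []ᵛ; _∷_ to _∷ᵛ_; _++_ to _++ᵛ_)
open import Data.Vec.Properties using (lookup∘tabulate; tabulate∘lookup; tabulate-cong)
  renaming (≡-dec to Vec-≡-dec)
open import Data.Product using (Σ; ∃; _×_; _,_; proj₁; proj₂)
open import Data.Sum using (_⊎_; inj₁; inj₂; [_,_]′)
open import Data.Empty using (⊥; ⊥-elim)
open import Data.Unit using (tt)
open import Function using (_∘_; id; case_of_)
open import Relation.Binary.Definitions using (tri<; tri≈; tri>)
open import Relation.Nullary using (¬_; Dec; yes; no; does)
open import Relation.Nullary.Decidable using (map′; ¬?; _×-dec_; _⊎-dec_; _→-dec_)
open import Relation.Binary.PropositionalEquality
  using (_≡_; _≢_; refl; sym; trans; cong; cong₂; subst; subst₂)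

-- No full automorphism group is determined. Each negative claim speaks of all automorphisms, or of
-- all subgroups given as arbitrary predicates, and is reduced to the finitely many maps with a
-- prescribed image of vertex 0. A regular subgroup, for instance, has exactly one element that
-- takes 0 to `c`, and is refuted through that element alone. Every decision is made by evaluation
-- during type checking; hence cosets become numbers and permutations become vectors of values. The
-- vertices `c`, `p`, `q`, the trees and the commutator elements are outside data, of which the
-- proof only uses that they pass the checks. A coset enumeration from generators covers only the
-- group generated by `H`, `a` and `b`. Where `G` is described differently, as a symmetric group or
-- as a direct product, the two groups must first be identified.

open DecMembership _≟_ using (_∈?_)
open module DecMembershipᶠ {n} = DecMembership (F._≟_ {n}) using () renaming (_∈?_ to _∈ᶠ?_)

-- Unlike toWitness, this leaves a boolean equation to the type checker, which is evaluated with
-- sharing.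
decided : ∀ {P : Set} (d : Dec P) → does d ≡ true → P
decided (yes p) _ = p

-- Neighbour tables and backtracking over embeddings

nth : ∀ {A : Set} → A → List A → ℕ → A
nth d []       _       = d
nth d (x ∷ xs) zero    = x
nth d (x ∷ xs) (suc k) = nth d xs k

nth-All : ∀ {A : Set} {P : A → Set} {d} {xs : List A} → P d → All P xs → ∀ k → P (nth d xs k)
nth-All pd []         _       = pd
nth-All pd (px ∷ pxs) zero    = px
nth-All pd (px ∷ pxs) (suc k) = nth-All pd pxs k

allBelow : ∀ {P : ℕ → Set} {m} → All P (upTo m) → ∀ {k} → k < m → P k
allBelow ps k<m = All.lookup ps (∈-upTo⁺ k<m)

-- Row k of a table lists the three neighbours of vertex k.
Table : Set
Table = List (ℕ × ℕ × ℕ)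

nbrs : Table → ℕ → List ℕ
nbrs T k with nth (0 , 0 , 0) T k
... | x , y , z = x ∷ y ∷ z ∷ []

-- In `adjacent` the conclusion exchanges the roles of `k` and `l`, because the search draws the new
-- value `f k` from the neighbour lists of values chosen before. `E-sym` pays for the exchange when
-- an isomorphism is turned into an embedding.
record Embedding (Γ Δ : Table) (f : ℕ → ℕ) : Set where
  field
    bounded   : ∀ {k} → k < length Γ → f k < length Δ
    adjacent  : ∀ {k l} → k < length Γ → l < length Γ → l ∈ nbrs Γ k → f k ∈ nbrs Δ (f l)
    injective : ∀ {k l} → k < length Γ → l < length Γ → f k ≡ f l → k ≡ l

valueAt : ℕ → List ℕ → ℕ → ℕ
valueAt k ys j = nth 0 ys (k ∸ suc j)

valueAt-downFrom : ∀ (f : ℕ → ℕ) k {j} → j < k → valueAt k (map f (downFrom k)) j ≡ f j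
valueAt-downFrom f (suc k) {j} j<1+k with m<1+n⇒m<n∨m≡n j<1+k
... | inj₂ refl rewrite n∸n≡0 k = refl
... | inj₁ j<k rewrite +-∸-assoc 1 j<k = valueAt-downFrom f k j<k

-- Backtracking over the embeddings of Γ into Δ.  A list ys of length k stands for the partial
-- map sending j < k to valueAt k ys j, i.e. the most recently chosen value comes first.
module Search (Γ Δ : Table) where

  earlier : ℕ → List ℕ
  earlier k = filter (_<? k) (nbrs Γ k)

  commonNbr? : ∀ ys c → Dec (All (λ y → c ∈ nbrs Δ y) ys)
  commonNbr? ys c = All.all? (λ y → c ∈? nbrs Δ y) ys

  -- A vertex with an earlier neighbour takes its candidates from a single row of the table, so the
  -- search branches at most three ways there; each further earlier neighbour closes a cycle and
  -- prunes.
  commonNbrs : List ℕ → List ℕ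
  commonNbrs []       = upTo (length Δ)
  commonNbrs (y ∷ ys) = filter (commonNbr? ys) (nbrs Δ y)

  choices : ℕ → List ℕ → List ℕ
  choices k ys = filter (λ c → ¬? (c ∈? ys)) (commonNbrs (map (valueAt k ys) (earlier k)))

  search : ℕ → ℕ → List ℕ → List (List ℕ)
  search zero    k ys = ys ∷ []
  search (suc r) k ys = concatMap (λ c → search r (suc k) (c ∷ ys)) (choices k ys)

  searchFrom : ℕ → List (List ℕ)
  searchFrom root = search (length Γ ∸ 1) 1 (root ∷ [])

  module _ {f : ℕ → ℕ} (emb : Embedding Γ Δ f) where
    open Embedding emb

    commonNbrs-complete : ∀ {c} ys → c < length Δ → (∀ {y} → y ∈ ys → c ∈ nbrs Δ y) →
                          c ∈ commonNbrs ys
    commonNbrs-complete []       c<m _   = ∈-upTo⁺ c<m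
    commonNbrs-complete (y ∷ ys) _   c∈ =
      ∈-filter⁺ (commonNbr? ys) (c∈ (here refl)) (All.tabulate (c∈ ∘ there))

    choices-complete : ∀ k → k < length Γ → f k ∈ choices k (map f (downFrom k))
    choices-complete k k<m =
      ∈-filter⁺ _ (commonNbrs-complete _ (bounded k<m) common) fresh
      where
      fresh : f k ∉ map f (downFrom k)
      fresh fk∈ with ∈-map⁻ f fk∈
      ... | j , j∈ , fk≡fj = <⇒≢ j<k (sym (injective k<m (<-trans j<k k<m) fk≡fj))
        where j<k = ∈-downFrom⁻ j∈
      common : ∀ {y} → y ∈ map (valueAt k (map f (downFrom k))) (earlier k) → f k ∈ nbrs Δ y
      common y∈ with ∈-map⁻ _ y∈
      ... | j , j∈ , refl with ∈-filter⁻ (_<? k) {xs = nbrs Γ k} j∈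
      ... | j∈nbrs , j<k rewrite valueAt-downFrom f k j<k =
        adjacent k<m (<-trans j<k k<m) j∈nbrs

    search-complete : ∀ r k → r + k ≡ length Γ →
                      map f (downFrom (length Γ)) ∈ search r k (map f (downFrom k))
    search-complete zero    k refl = here refl
    search-complete (suc r) k eq   =
      ∈-concatMap⁺ _ (lose (choices-complete k k<m)
        (search-complete r (suc k) (trans (+-suc r k) eq)))
      where k<m = subst (k <_) eq (s≤s (m≤n+m k r))

    searchFrom-complete : ∀ {root} → 0 < length Γ → f 0 ≡ root →
                          map f (downFrom (length Γ)) ∈ searchFrom root
    searchFrom-complete 0<m refl =
      search-complete (length Γ ∸ 1) 1 (trans (+-comm (length Γ ∸ 1) 1) (m+[n∸m]≡n 0<m))

-- Transport between setoid graphs and tables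

open Search using (searchFrom; searchFrom-complete)

-- Codes are a faithful copy of the graph, so that isomorphisms can be studied as functions on
-- numbers. `rep` is total, but its values are constrained only below `length T`.
record Presentation (Γ : Graph) (T : Table) : Set where
  open Graph Γ
  field
    nonempty  : 0 < length T
    code      : V → ℕ
    rep       : ℕ → V
    code<     : ∀ u → code u < length T
    code-rep  : ∀ {k} → k < length T → code (rep k) ≡ k
    ≃⇒code    : ∀ {u v} → u ≃ v → code u ≡ code v
    code⇒≃    : ∀ {u v} → code u ≡ code v → u ≃ v
    E⇒nbr     : ∀ {u v} → E u v → code v ∈ nbrs T (code u)
    nbr⇒E     : ∀ {u v} → code v ∈ nbrs T (code u) → E u v
    E-sym     : ∀ {u v} → E u v → E v u

  ≃-refl : ∀ {u} → u ≃ u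
  ≃-refl = code⇒≃ refl

  ≃-sym : ∀ {u v} → u ≃ v → v ≃ u
  ≃-sym p = code⇒≃ (sym (≃⇒code p))

  ≃-trans : ∀ {u v w} → u ≃ v → v ≃ w → u ≃ w
  ≃-trans p q = code⇒≃ (trans (≃⇒code p) (≃⇒code q))

  E-cong : ∀ {u u′ v v′} → u ≃ u′ → v ≃ v′ → E u v → E u′ v′
  E-cong p q e = nbr⇒E (subst₂ (λ k l → l ∈ nbrs T k) (≃⇒code p) (≃⇒code q) (E⇒nbr e))

  rep-code : ∀ u → rep (code u) ≃ u
  rep-code u = code⇒≃ (code-rep (code< u))

  rep-injective : ∀ {k l} → k < length T → l < length T → rep k ≃ rep l → k ≡ l
  rep-injective k<m l<m p = trans (sym (code-rep k<m)) (trans (≃⇒code p) (code-rep l<m))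

  nbr⇒E-rep : ∀ {k l} → k < length T → l < length T → l ∈ nbrs T k → E (rep k) (rep l)
  nbr⇒E-rep k<m l<m l∈ =
    nbr⇒E (subst₂ (λ i j → j ∈ nbrs T i) (sym (code-rep k<m)) (sym (code-rep l<m)) l∈)

open Iso

module _ {Γ Δ T U} (P : Presentation Γ T) (Q : Presentation Δ U) where
  private
    module P = Presentation P
    module Q = Presentation Q
  open Graph Δ

  onCodes : Iso Γ Δ → ℕ → ℕ
  onCodes φ k = Q.code (to φ (P.rep k))

  embedding : (φ : Iso Γ Δ) → Embedding T U (onCodes φ)
  embedding φ = record
    { bounded   = λ _ → Q.code< _
    ; adjacent  = λ k<m l<m l∈ → Q.E⇒nbr (Q.E-sym (hom φ _ _ (P.nbr⇒E-rep k<m l<m l∈)))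
    ; injective = λ k<m l<m eq → P.rep-injective k<m l<m
        (P.≃-trans (P.≃-sym (from-to φ _))
          (P.≃-trans (from-cong φ (Q.code⇒≃ eq)) (from-to φ _)))
    }

  composeAut : Iso Γ Δ → Aut Δ → Iso Γ Δ
  composeAut φ α = record
    { to        = to α ∘ to φ
    ; from      = from φ ∘ from α
    ; to-cong   = to-cong α ∘ to-cong φ
    ; from-cong = from-cong φ ∘ from-cong α
    ; to-from   = λ v → Q.≃-trans (to-cong α (to-from φ _)) (to-from α v)
    ; from-to   = λ v → P.≃-trans (from-cong φ (from-to α _)) (from-to φ v)
    ; hom       = λ u v → hom α _ _ ∘ hom φ u v
    ; hom⁻      = λ u v → hom⁻ φ u v ∘ hom⁻ α _ _
    }

  -- Following `φ` by an automorphism of `Δ` makes it send vertex 0 to vertex 0, so an empty search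
  -- from that single root excludes every isomorphism.
  nonIsomorphic : VertexTransitive Δ → searchFrom T U 0 ≡ [] → ¬ Iso Γ Δ
  nonIsomorphic vt empty φ with vt (to φ (P.rep 0)) (Q.rep 0)
  ... | α , α↦0
    with found ← searchFrom-complete T U (embedding (composeAut φ α)) P.nonempty
                   (trans (Q.≃⇒code α↦0) (Q.code-rep Q.nonempty))
    rewrite empty with () ← found

  Iso-sym : Iso Γ Δ → Iso Δ Γ
  Iso-sym φ = record
    { to        = from φ
    ; from      = to φ
    ; to-cong   = from-cong φ
    ; from-cong = to-cong φ
    ; to-from   = from-to φ
    ; from-to   = to-from φ
    ; hom       = λ u v e → hom⁻ φ _ _
        (Q.E-cong (Q.≃-sym (to-from φ u)) (Q.≃-sym (to-from φ v)) e)
    ; hom⁻      = λ u v e →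
        Q.E-cong (to-from φ u) (to-from φ v) (hom φ _ _ e)
    }

-- Certificates for connectedness, valency and the negative properties

FixesButMoves : ℕ → (ℕ → ℕ) → Set
FixesButMoves m g = Any (λ w → g w ≡ w) (upTo m) × Any (λ w → g w ≢ w) (upTo m)

fixesButMoves? : ∀ m g → Dec (FixesButMoves m g)
fixesButMoves? m g = any? (λ w → g w ≟ w) _ ×-dec any? (λ w → ¬? (g w ≟ w)) _

-- In a regular subgroup only the identity fixes a vertex, and the square of a member agrees with a
-- member. For the chosen `c` the first and second powers are enough.
Irregular : ℕ → List ℕ → Set
Irregular m ys = FixesButMoves m g ⊎ FixesButMoves m (g ∘ g)
  where g = valueAt m ys

irregular? : ∀ m ys → Dec (Irregular m ys)
irregular? m ys = fixesButMoves? m _ ⊎-dec fixesButMoves? m _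

record Certificate (T : Table) (c p q : ℕ) : Set where
  field
    -- A smaller neighbour of every nonzero vertex gives a descent to 0; it also guarantees that the
    -- search always has a row to choose from.
    connected : All (λ k → k ≡ 0 ⊎ Any (_< k) (nbrs T k)) (upTo (length T))
    simple    : All (λ { (x , y , z) → x ≢ y × x ≢ z × y ≢ z ×
                                     x < length T × y < length T × z < length T }) T
    c<        : c < length T
    notCayley : All (Irregular (length T)) (searchFrom T T c)
    p<        : p < length T
    q<        : q < length T
    p∈        : p ∈ nbrs T 0
    q∈        : q ∈ nbrs T 0
    notSym    : All (λ ys → valueAt (length T) ys p ≢ q) (searchFrom T T 0)

certificate? : ∀ T c p q → Dec (Certificate T c p q)
certificate? T c p q = map′
  (λ (a , b , c , d , e , f , g , h , i) → record
    { connected = a ; simple = b ; c< = c ; notCayley = d ; p< = e ; q< = f ; p∈ = g ; q∈ = h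
    ; notSym = i })
  (λ C → let open Certificate C in
    connected , simple , c< , notCayley , p< , q< , p∈ , q∈ , notSym)
  (All.all? (λ k → (k ≟ 0) ⊎-dec any? (_<? k) _) _ ×-dec
   All.all? (λ (x , y , z) → ¬? (x ≟ y) ×-dec ¬? (x ≟ z) ×-dec ¬? (y ≟ z) ×-dec
                             (x <? _) ×-dec (y <? _) ×-dec (z <? _)) _ ×-dec
   (c <? _) ×-dec All.all? (irregular? _) _ ×-dec (p <? _) ×-dec (q <? _) ×-dec
   (p ∈? _) ×-dec (q ∈? _) ×-dec All.all? (λ ys → ¬? (valueAt (length T) ys p ≟ q)) _)

module Properties {Γ T} (P : Presentation Γ T) {c p q} (C : Certificate T c p q) where
  open Graph Γ
  open Presentation P
  open Certificate C

  joinWalks : ∀ {u v v′ w} → Walk Γ u v → v ≃ v′ → Walk Γ v′ w → Walk Γ u w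
  joinWalks (stop p)    q (stop r)    = stop (≃-trans p (≃-trans q r))
  joinWalks (stop p)    q (step e w) = step (E-cong (≃-sym (≃-trans p q)) ≃-refl e) w
  joinWalks (step e w) q w′          = step e (joinWalks w q w′)

  reverseWalk : ∀ {u v} → Walk Γ u v → Walk Γ v u
  reverseWalk (stop p)    = stop (≃-sym p)
  reverseWalk (step e w) = joinWalks (reverseWalk w) ≃-refl (step (E-sym e) (stop ≃-refl))

  walkToRoot : ∀ k → k < length T → Walk Γ (rep k) (rep 0)
  walkToRoot = <-rec _ λ k rec k<m → case allBelow connected k<m of λ where
      (inj₁ refl) → stop ≃-refl
      (inj₂ back) → let j , j∈ , j<k = find back
                        j<m = <-trans j<k k<m in
        step (nbr⇒E-rep k<m j<m j∈) (rec j<k j<m)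

  isConnected : Connected Γ
  isConnected u v = joinWalks (down u) ≃-refl (reverseWalk (down v))
    where
    down : ∀ u → Walk Γ u (rep 0)
    down u = joinWalks (stop (≃-sym (rep-code u))) ≃-refl (walkToRoot _ (code< u))

  isCubic : Cubic Γ
  isCubic v = rep x , rep y , rep z ,
      nbr⇒E (∈row x< (here refl)) , nbr⇒E (∈row y< (there (here refl))) ,
      nbr⇒E (∈row z< (there (there (here refl)))) ,
      x≢y ∘ rep-injective x< y< , x≢z ∘ rep-injective x< z< , y≢z ∘ rep-injective y< z< ,
      λ w e → split w (E⇒nbr e)
    where
    -- The default row `(0 , 0 , 0)` violates distinctness, so `nth-All` cannot serve here and the
    -- bound on the index has to be used.
    row : ∀ {P : ℕ × ℕ × ℕ → Set} T → All P T → ∀ {k} → k < length T → P (nth (0 , 0 , 0) T k)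
    row (_ ∷ T) (px ∷ pxs) {zero}  _         = px
    row (_ ∷ T) (px ∷ pxs) {suc k} (s≤s k<) = row T pxs k<
    x = proj₁ (nth (0 , 0 , 0) T (code v))
    y = proj₁ (proj₂ (nth (0 , 0 , 0) T (code v)))
    z = proj₂ (proj₂ (nth (0 , 0 , 0) T (code v)))
    facts = row T simple (code< v)
    x≢y = proj₁ facts
    x≢z = proj₁ (proj₂ facts)
    y≢z = proj₁ (proj₂ (proj₂ facts))
    x<  = proj₁ (proj₂ (proj₂ (proj₂ facts)))
    y<  = proj₁ (proj₂ (proj₂ (proj₂ (proj₂ facts))))
    z<  = proj₂ (proj₂ (proj₂ (proj₂ (proj₂ facts))))
    ∈row : ∀ {k} → k < length T → k ∈ nbrs T (code v) → code (rep k) ∈ nbrs T (code v)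
    ∈row k< = subst (_∈ nbrs T (code v)) (sym (code-rep k<))
    is : ∀ {w k} → code w ≡ k → w ≃ rep k
    is refl = ≃-sym (rep-code _)
    split : ∀ w → code w ∈ nbrs T (code v) → w ≃ rep x ⊎ w ≃ rep y ⊎ w ≃ rep z
    split w (here p)                 = inj₁ (is p)
    split w (there (here p))         = inj₂ (inj₁ (is p))
    split w (there (there (here p))) = inj₂ (inj₂ (is p))

  values : Aut Γ → List ℕ
  values φ = map (onCodes P P φ) (downFrom (length T))

  valueAt-values : ∀ φ {k} → k < length T → valueAt (length T) (values φ) k ≡ onCodes P P φ k
  valueAt-values φ = valueAt-downFrom (onCodes P P φ) (length T)

  values-found : ∀ φ {k} → k < length T → to φ (rep 0) ≃ rep k → values φ ∈ searchFrom T T k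
  values-found φ k<m eq =
    searchFrom-complete T T (embedding P P φ) nonempty (trans (≃⇒code eq) (code-rep k<m))

  isNotSymmetric : ¬ Symmetric Γ
  isNotSymmetric sy
    with sy (rep 0) (rep p) (rep 0) (rep q) (nbr⇒E-rep nonempty p< p∈) (nbr⇒E-rep nonempty q< q∈)
  ... | φ , 0↦0 , p↦q = All.lookup notSym (values-found φ nonempty 0↦0)
    (trans (valueAt-values φ p<) (trans (≃⇒code p↦q) (code-rep q<)))

  isNotCayley : ¬ Cayley Γ
  isNotCayley (R , ((ε , Rε , ε≃id) , R-mul , _) , regular)
    with regular (rep 0) (rep c)
  ... | φ , Rφ , 0↦c , _ =
      [ refute φ Rφ (λ k<m → valueAt-values φ k<m)
      , refute φ² (proj₁ (proj₂ (R-mul φ φ Rφ Rφ))) square ]′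
      (All.lookup notCayley (values-found φ c< 0↦c))
    where
    -- The uniqueness clause for the pair `u`, `u` is applied to `ψ` and to the identity `ε` of `R`,
    -- which forces the two to agree everywhere.
    semiregular : ∀ ψ → R ψ → ∀ u → to ψ u ≃ u → ∀ v → to ψ v ≃ v
    semiregular ψ Rψ u fix v with regular u u
    ... | _ , _ , _ , unique =
      ≃-trans (unique ψ Rψ fix v) (≃-trans (≃-sym (unique ε Rε (ε≃id u) v)) (ε≃id v))
    refute : ∀ ψ {g} → R ψ → (∀ {k} → k < length T → g k ≡ onCodes P P ψ k) →
             ¬ FixesButMoves (length T) g
    refute ψ Rψ g≡ψ (fixed , moved)
      with w , w∈ , gw≡w ← find fixed | w′ , w′∈ , gw′≢w′ ← find moved =
      gw′≢w′ (trans (g≡ψ w′<m) (trans (≃⇒code (semiregular ψ Rψ (rep w) ψw≃w (rep w′)))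
                                       (code-rep w′<m)))
      where
      w<m  = ∈-upTo⁻ w∈
      w′<m = ∈-upTo⁻ w′∈
      ψw≃w : to ψ (rep w) ≃ rep w
      ψw≃w = code⇒≃ (trans (sym (g≡ψ w<m)) (trans gw≡w (sym (code-rep w<m))))
    φ² = proj₁ (R-mul φ φ Rφ Rφ)
    g  = valueAt (length T) (values φ)
    -- On codes, the first image is replaced by the representative of its vertex before `φ` is
    -- applied again; `to-cong` absorbs this replacement.
    square : ∀ {k} → k < length T → g (g k) ≡ onCodes P P φ² k
    square {k} k<m = trans (cong g (valueAt-values φ k<m))
      (trans (valueAt-values φ (code< _))
        (≃⇒code (≃-trans (to-cong φ (rep-code _)) (≃-sym (proj₂ (proj₂ (R-mul φ φ Rφ Rφ)) _)))))

-- Assembling the properties of a family of graphs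

record Facts (Γ : Graph) (T : Table) : Set₁ where
  field
    presentation     : Presentation Γ T
    connected        : Connected Γ
    cubic            : Cubic Γ
    vertexTransitive : VertexTransitive Γ
    notSymmetric     : ¬ Symmetric Γ
    notCayley        : ¬ Cayley Γ
    notSolvable      : ¬ SolvableAut Γ

module _ {n} {Γ : Fin n → Graph} {T : Fin n → Table} (facts : ∀ i → Facts (Γ i) (T i))
         (noEmbeddings : ∀ i j → i F< j → searchFrom (T i) (T j) 0 ≡ []) where
  open Facts

  pairwiseNonIsomorphic : ∀ i j → i ≢ j → ¬ Iso (Γ i) (Γ j)
  pairwiseNonIsomorphic i j i≢j φ = case F.<-cmp i j of λ where
      (tri< i<j _ _) → ordered i<j φ
      (tri≈ _ i≡j _) → i≢j i≡j
      -- Searches are run for the smaller index into the larger only, so this order passes to the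
      -- inverse isomorphism.
      (tri> _ _ j<i) → ordered j<i
        (Iso-sym (presentation (facts i)) (presentation (facts j)) φ)
    where
    ordered : ∀ {i j} → i F< j → ¬ Iso (Γ i) (Γ j)
    ordered {i} {j} i<j = nonIsomorphic (presentation (facts i)) (presentation (facts j))
      (vertexTransitive (facts j)) (noEmbeddings i j i<j)

  allProperties : ∀ i → Connected (Γ i) × Cubic (Γ i) × VertexTransitive (Γ i) ×
                        ¬ Symmetric (Γ i) × ¬ Cayley (Γ i) × ¬ SolvableAut (Γ i)
  allProperties i =
    connected (facts i) , cubic (facts i) , vertexTransitive (facts i) ,
    notSymmetric (facts i) , notCayley (facts i) , notSolvable (facts i)

-- Generated permutation groups and tabulated permutations

module _ {n : ℕ} where

  ≈-trans : {f g h : Fin n → Fin n} → (∀ i → f i ≡ g i) → (∀ i → g i ≡ h i) → ∀ i → f i ≡ h i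
  ≈-trans e f i = trans (e i) (f i)

  ·-congˡ : (q : Perm n) {f g : Fin n → Fin n} → (∀ i → f i ≡ g i) →
            ∀ i → q ⟨$⟩ʳ f i ≡ q ⟨$⟩ʳ g i
  ·-congˡ q e i = cong (q ⟨$⟩ʳ_) (e i)

  ⁻¹-cong : (p q : Perm n) → p ≈ₚ q → p ⁻¹ ≈ₚ q ⁻¹
  ⁻¹-cong p q e i =
    trans (cong (p ⟨$⟩ˡ_) (sym (inverseʳ q))) (trans (cong (p ⟨$⟩ˡ_) (sym (e _))) (inverseˡ p))

  ⟨⟩-resp : ∀ {S} {p q : Perm n} → p ≈ₚ q → ⟨ S ⟩ p → ⟨ S ⟩ q
  ⟨⟩-resp e m = mul m (one {p = idP} λ _ → refl) (sym ∘ e)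

  ⟨⟩-∈ : ∀ {S} {p : Perm n} → p ∈ S → ⟨ S ⟩ p
  ⟨⟩-∈ p∈S = gen p∈S λ _ → refl

  ⟨⟩-· : ∀ {S} {p q : Perm n} → ⟨ S ⟩ p → ⟨ S ⟩ q → ⟨ S ⟩ (p · q)
  ⟨⟩-· m m′ = mul m m′ λ _ → refl

  ⟨⟩-⁻¹ : ∀ {S} {p : Perm n} → ⟨ S ⟩ p → ⟨ S ⟩ (p ⁻¹)
  ⟨⟩-⁻¹ m = inv m λ _ → refl

  ⟨⟩-least : ∀ {S S′} → (∀ {s : Perm n} → s ∈ S → ⟨ S′ ⟩ s) → ∀ {p} → ⟨ S ⟩ p → ⟨ S′ ⟩ p
  ⟨⟩-least S⊆ (gen q∈S e)  = ⟨⟩-resp (sym ∘ e) (S⊆ q∈S)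
  ⟨⟩-least S⊆ (one e)      = one e
  ⟨⟩-least S⊆ (mul m m′ e) = mul (⟨⟩-least S⊆ m) (⟨⟩-least S⊆ m′) e
  ⟨⟩-least S⊆ (inv m e)    = inv (⟨⟩-least S⊆ m) e

  module _ {S : List (Perm n)} {U : Perm n → Set}
           (resp : ∀ {p q} → p ≈ₚ q → U p → U q)
           (closed : ∀ {s q} → s ∈ S → U q → U (s · q) × U (s ⁻¹ · q)) where

    -- Multiplication by `p` and by its inverse are carried along together: then `inv` merely swaps
    -- the two halves, and `mul` composes the inverse halves in the opposite order. If `U` holds of
    -- the identity, it follows that `U` holds on the whole group.
    ⟨⟩-preserves : ∀ {p} → ⟨ S ⟩ p → ∀ {q} → U q → U (p · q) × U (p ⁻¹ · q)
    ⟨⟩-preserves {p} (gen {q = s} s∈S e) {q} u =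
      resp (·-congˡ q (sym ∘ e)) (proj₁ (closed s∈S u)) ,
      resp (·-congˡ q (⁻¹-cong s p (sym ∘ e))) (proj₂ (closed s∈S u))
    ⟨⟩-preserves {p} (one e) {q} u =
      resp (·-congˡ q (sym ∘ e)) u ,
      resp (·-congˡ q (⁻¹-cong idP p (sym ∘ e))) u
    ⟨⟩-preserves {r} (mul {p} {p′} m m′ e) {q} u =
      resp (·-congˡ q (sym ∘ e))
        (proj₁ (⟨⟩-preserves m (proj₁ (⟨⟩-preserves m′ u)))) ,
      resp (·-congˡ q (⁻¹-cong (p · p′) r (sym ∘ e)))
        (proj₂ (⟨⟩-preserves m′ (proj₂ (⟨⟩-preserves m u))))
    ⟨⟩-preserves {r} (inv {p} m e) {q} u =
      resp (·-congˡ q (sym ∘ e)) (proj₂ (⟨⟩-preserves m u)) ,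
      resp (·-congˡ q (⁻¹-cong (p ⁻¹) r (sym ∘ e))) (proj₁ (⟨⟩-preserves m u))

-- Not a map, since partial applications would lose the sharing of w during evaluation.
compose : ∀ {n k} → Vec (Fin n) k → Vec (Fin n) n → Vec (Fin n) k
compose []ᵛ      w = []ᵛ
compose (i ∷ᵛ v) w = lookup w i ∷ᵛ compose v w

lookup-compose : ∀ {n k} (v : Vec (Fin n) k) w i → lookup (compose v w) i ≡ lookup w (lookup v i)
lookup-compose (_ ∷ᵛ v) w zero    = refl
lookup-compose (_ ∷ᵛ v) w (suc i) = lookup-compose v w i

-- A permutation with its list of values, so that products are compared without re-evaluating
-- the factors.  With eta equality the evaluated list would not be shared.
record Tabulated (n : ℕ) : Set where
  no-eta-equality
  pattern
  constructor tabulated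
  field
    perm   : Perm n
    vals   : Vec (Fin n) n
    agrees : ∀ i → lookup vals i ≡ perm ⟨$⟩ʳ i
open Tabulated

tab : ∀ {n} → Perm n → Tabulated n
tab p = tabulated p (tabulate (p ⟨$⟩ʳ_)) (lookup∘tabulate _)

infixl 7 _∙_
_∙_ : ∀ {n} → Tabulated n → Tabulated n → Tabulated n
x ∙ y = tabulated (perm x · perm y) (compose (vals x) (vals y)) λ i →
  trans (lookup-compose (vals x) (vals y) i)
    (trans (agrees y _) (cong (perm y ⟨$⟩ʳ_) (agrees x i)))

inverse : ∀ {n} → Tabulated n → Tabulated n
inverse x = tab (perm x ⁻¹)

ε : ∀ {n} → Tabulated n
ε = tab idP

_≟ᵛ_ : ∀ {n} (v w : Vec (Fin n) n) → Dec (v ≡ w)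
_≟ᵛ_ = Vec-≡-dec F._≟_

lookup-injective : ∀ {n m} {v w : Vec (Fin m) n} → (∀ i → lookup v i ≡ lookup w i) → v ≡ w
lookup-injective {v = v} {w} e =
  trans (sym (tabulate∘lookup v)) (trans (tabulate-cong e) (tabulate∘lookup w))

infix 4 _≋_ _≋?_
_≋_ : ∀ {n} → Tabulated n → Tabulated n → Set
x ≋ y = vals x ≡ vals y

_≋?_ : ∀ {n} (x y : Tabulated n) → Dec (x ≋ y)
x ≋? y = vals x ≟ᵛ vals y

≋⇒≈ : ∀ {n} (x y : Tabulated n) → x ≋ y → perm x ≈ₚ perm y
≋⇒≈ x y e i = trans (sym (agrees x i)) (trans (cong (λ v → lookup v i) e) (agrees y i))

≈⇒≋ : ∀ {n} (x y : Tabulated n) → perm x ≈ₚ perm y → x ≋ y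
≈⇒≋ x y e = lookup-injective λ i → trans (agrees x i) (trans (e i) (sym (agrees y i)))

-- For commuting involutions xs this is the generated group.
subproducts : ∀ {n} → List (Tabulated n) → List (Tabulated n)
subproducts []       = ε ∷ []
subproducts (x ∷ xs) = subproducts xs ++ˡ map (x ∙_) (subproducts xs)

subproducts-⟨⟩ : ∀ {n} {S : List (Perm n)} {xs} → (∀ {x} → x ∈ xs → ⟨ S ⟩ (perm x)) →
                 ∀ {y} → y ∈ subproducts xs → ⟨ S ⟩ (perm y)
subproducts-⟨⟩ {xs = []}     _    (here refl) = one λ _ → refl
subproducts-⟨⟩ {xs = x ∷ xs} xs⊆ y∈ with ∈-++⁻ (subproducts xs) y∈
... | inj₁ y∈ = subproducts-⟨⟩ (xs⊆ ∘ there) y∈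
... | inj₂ y∈ with z , z∈ , refl ← ∈-map⁻ (x ∙_) y∈ =
  ⟨⟩-· (xs⊆ (here refl)) (subproducts-⟨⟩ (xs⊆ ∘ there) z∈)

-- The pair (k , j) appends the product of the j-th step and the k-th element found so far.
grow : ∀ {n} → List (Tabulated n) → List (ℕ × ℕ) → List (Tabulated n) → List (Tabulated n)
grow steps []               R = R
grow steps ((k , j) ∷ tree) R = grow steps tree (R ++ˡ (nth ε steps j ∙ nth ε R k) ∷ [])

-- Coset graphs and their presentation by tables

module CosetTable {n : ℕ} (hs : List (Perm n)) (a b : Perm n)
                  (tree : List (ℕ × ℕ)) (T : Table) where

  gens : List (Perm n)
  gens = hs ++ˡ a ∷ b ∷ []

  m : ℕ
  m = length T

  -- Since `HaH` is the union of the cosets `Hah` with `h` in `H`, each `Hdg` with `d` in the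
  -- connection set has the form `Hxhg` with `x` equal to `a` or `b`. The products with `a` come
  -- before those with `b`, which decodes the second components in the trees.
  H-elements steps reps : List (Tabulated n)
  H-elements = subproducts (map tab hs)
  steps      = cartesianProductWith _∙_ (tab a ∷ tab b ∷ []) H-elements
  reps       = grow steps tree (ε ∷ [])

  rep : ℕ → Tabulated n
  rep = nth ε reps

  -- Seen from its end `Hdg`, an edge leads back to `Hg` through an inverse of `a` or `b`. Closure
  -- under the generated group calls for the inverses as well.
  connectors : List (Tabulated n)
  connectors = tab a ∷ inverse (tab a) ∷ tab b ∷ inverse (tab b) ∷ []

  -- The lists are parameters so that they are evaluated only once.
  record Valid (H reps steps : List (Tabulated n)) : Set where
    field
      H-closed   : All (λ s → All (λ h → Any (s ∙ h ≋_) H × Any (inverse s ∙ h ≋_) H) H)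
                     (map tab hs)
      nonempty   : 0 < m
      root       : nth ε reps 0 ≋ ε
      distinct   : All (λ k → All (λ l → k ≡ l ⊎
                     All (λ h → ¬ (nth ε reps k ≋ h ∙ nth ε reps l)) H) (upTo m)) (upTo m)
      nbrs<      : All (λ k → All (_< m) (nbrs T k)) (upTo m)
      steps⇒nbrs : All (λ k → All (λ x → All (λ h → Any (λ l → Any (λ h′ →
                     x ∙ (h ∙ nth ε reps k) ≋ h′ ∙ nth ε reps l) H) (nbrs T k)) H)
                     connectors) (upTo m)
      nbrs⇒steps : All (λ k → All (λ l → Any (λ x → Any (λ h → Any (λ h′ →
                     nth ε reps l ≋ h′ ∙ ((x ∙ h) ∙ nth ε reps k)) H) H)
                     (tab a ∷ tab b ∷ [])) (nbrs T k)) (upTo m)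

  valid? : ∀ H reps steps → Dec (Valid H reps steps)
  valid? H reps steps = map′
    (λ (a , b , c , d , e , f , g) → record
      { H-closed = a ; nonempty = b ; root = c ; distinct = d ; nbrs< = e ; steps⇒nbrs = f
      ; nbrs⇒steps = g })
    (λ v → let open Valid v in
      H-closed , nonempty , root , distinct , nbrs< , steps⇒nbrs , nbrs⇒steps)
    (All.all? (λ s → All.all? (λ h → any? (s ∙ h ≋?_) H ×-dec any? (inverse s ∙ h ≋?_) H) H) _ ×-dec
     (0 <? m) ×-dec (nth ε reps 0 ≋? ε) ×-dec
     All.all? (λ k → All.all? (λ l → (k ≟ l) ⊎-dec
       All.all? (λ h → ¬? (nth ε reps k ≋? h ∙ nth ε reps l)) H) _) _ ×-dec
     All.all? (λ k → All.all? (_<? m) _) _ ×-dec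
     All.all? (λ k → All.all? (λ x → All.all? (λ h → any? (λ l → any? (λ h′ →
       x ∙ (h ∙ nth ε reps k) ≋? h′ ∙ nth ε reps l) H) _) H) _) _ ×-dec
     All.all? (λ k → All.all? (λ l → any? (λ x → any? (λ h → any? (λ h′ →
       nth ε reps l ≋? h′ ∙ ((x ∙ h) ∙ nth ε reps k)) H) H) _) _) _)

  -- The subgroup generated by `X` equals its own derived subgroup, and a member of `X` outside `H`
  -- moves the vertex `H`, so this perfect subgroup acts nontrivially.
  Perfect : (H X : List (Tabulated n)) → Set
  Perfect H X =
    All (λ x → Any (λ y → Any (λ z → x ≋ inverse y ∙ inverse z ∙ y ∙ z) X) X) X ×
    Any (λ x → All (λ h → ¬ (x ≋ h)) H) X

  perfect? : ∀ H X → Dec (Perfect H X)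
  perfect? H X =
    All.all? (λ x → any? (λ y → any? (λ z → x ≋? inverse y ∙ inverse z ∙ y ∙ z) X) X) X ×-dec
    any? (λ x → All.all? (λ h → ¬? (x ≋? h)) H) X

  -- An element of `H` times a coset representative is a general group element, so pairs of indices
  -- address the group. For two generators of `H` the first index runs through the identity, `h₂`,
  -- `h₁` and `h₁ · h₂`.
  elements : List (ℕ × ℕ) → List (Tabulated n)
  elements = map λ (i , k) → nth ε H-elements i ∙ rep k

  a∈ : a ∈ gens
  a∈ = ∈-++⁺ʳ hs (here refl)

  b∈ : b ∈ gens
  b∈ = ∈-++⁺ʳ hs (there (here refl))

  H-elements-⟨⟩ : ∀ {h} → h ∈ H-elements → ⟨ hs ⟩ (perm h)
  H-elements-⟨⟩ = subproducts-⟨⟩ {xs = map tab hs} λ x∈ →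
    case ∈-map⁻ tab x∈ of λ where (_ , s∈ , refl) → ⟨⟩-∈ s∈

  H⇒⟨gens⟩ : ∀ {p} → ⟨ hs ⟩ p → ⟨ gens ⟩ p
  H⇒⟨gens⟩ = ⟨⟩-least (⟨⟩-∈ ∘ ∈-++⁺ˡ)

  steps-⟨⟩ : All (⟨ gens ⟩ ∘ perm) steps
  steps-⟨⟩ = All.tabulate λ s∈ →
    case ∈-cartesianProductWith⁻ _∙_ (tab a ∷ tab b ∷ []) H-elements s∈ of λ where
      (_ , _ , here refl , h∈ , refl)         → ⟨⟩-· (⟨⟩-∈ a∈) (H⇒⟨gens⟩ (H-elements-⟨⟩ h∈))
      (_ , _ , there (here refl) , h∈ , refl) → ⟨⟩-· (⟨⟩-∈ b∈) (H⇒⟨gens⟩ (H-elements-⟨⟩ h∈))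

  ⟨⟩-ε : ∀ {S : List (Perm n)} → ⟨ S ⟩ (perm ε)
  ⟨⟩-ε = one λ _ → refl

  reps-All : All (⟨ gens ⟩ ∘ perm) reps
  reps-All = growing tree (⟨⟩-ε ∷ [])
    where
    growing : ∀ tree {R} → All (⟨ gens ⟩ ∘ perm) R → All (⟨ gens ⟩ ∘ perm) (grow steps tree R)
    growing []               R⊆ = R⊆
    growing ((k , j) ∷ tree) R⊆ = growing tree
      (All.++⁺ R⊆ (⟨⟩-· (nth-All ⟨⟩-ε steps-⟨⟩ j) (nth-All ⟨⟩-ε R⊆ k) ∷ []))

  reps-⟨⟩ : ∀ k → ⟨ gens ⟩ (perm (rep k))
  reps-⟨⟩ = nth-All ⟨⟩-ε reps-All

  group : List (Tabulated n)
  group = cartesianProductWith _∙_ H-elements reps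

  Listed : List (Tabulated n) → Vec (Fin n) n → Set
  Listed xs v = Any (λ x → v ≡ vals x) xs

  listed? : ∀ xs v → Dec (Listed xs v)
  listed? xs v = any? (λ x → v ≟ᵛ vals x) xs

  listed⇒⟨⟩ : ∀ {p v} → (∀ i → lookup v i ≡ p ⟨$⟩ʳ i) → Listed group v → ⟨ gens ⟩ p
  listed⇒⟨⟩ {p} {v} v≡p listed =
    let x , x∈ , v≡x = find listed
        h , r , h∈ , r∈ , x≡hr = ∈-cartesianProductWith⁻ _∙_ H-elements reps x∈ in
    ⟨⟩-resp (λ i → trans (sym (cong (λ y → perm y ⟨$⟩ʳ i) x≡hr))
                     (trans (sym (agrees x i)) (trans (cong (λ w → lookup w i) (sym v≡x)) (v≡p i))))
      (⟨⟩-· (H⇒⟨gens⟩ (H-elements-⟨⟩ h∈)) (All.lookup reps-All r∈))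

  elements-⟨⟩ : ∀ xs {x} → x ∈ elements xs → ⟨ gens ⟩ (perm x)
  elements-⟨⟩ xs x∈ = case ∈-map⁻ _ x∈ of λ where
    ((i , k) , _ , refl) →
      ⟨⟩-· (H⇒⟨gens⟩ (nth-All ⟨⟩-ε (All.tabulate H-elements-⟨⟩) i)) (reps-⟨⟩ k)

  infix 4 _~_
  _~_ : Perm n → Perm n → Set
  p ~ q = ⟨ hs ⟩ (p · q ⁻¹)

  ~-intro : ∀ {h} p q → ⟨ hs ⟩ h → p ≈ₚ h · q → p ~ q
  ~-intro p q h∈ e = ⟨⟩-resp (λ i → sym (trans (cong (q ⟨$⟩ˡ_) (e i)) (inverseˡ q))) h∈

  ~-elim : ∀ p q → p ~ q → p ≈ₚ p · q ⁻¹ · q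
  ~-elim p q _ i = sym (inverseʳ q)

  ≈⇒~ : ∀ p q → p ≈ₚ q → p ~ q
  ≈⇒~ p q e = ~-intro {idP} p q (one λ _ → refl) e

  ~-sym : ∀ p q → p ~ q → q ~ p
  ~-sym p q p~q = ⟨⟩-resp (λ _ → refl) (⟨⟩-⁻¹ p~q)

  ~-trans : ∀ p q r → p ~ q → q ~ r → p ~ r
  ~-trans p q r p~q q~r =
    mul p~q q~r λ i → cong (r ⟨$⟩ˡ_) (sym (inverseʳ q))

  ~-·ʳ : ∀ p q x → p ~ q → p · x ~ q · x
  ~-·ʳ p q x = ⟨⟩-resp λ i → cong (q ⟨$⟩ˡ_) (sym (inverseˡ x))

  ·-~ : ∀ {h} p → ⟨ hs ⟩ h → h · p ~ p
  ·-~ {h} p h∈ = ~-intro (h · p) p h∈ λ _ → refl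

  Validated : Set
  Validated = does (valid? H-elements reps steps) ≡ true

  module Cosets (validated : Validated) where
    open Valid (decided (valid? H-elements reps steps) validated)

    -- The list contains the identity and, by `H-closed`, is stable under left multiplication by
    -- each generator and its inverse; `⟨⟩-preserves` extends this to the whole group.
    H-complete : ∀ {p} → ⟨ hs ⟩ p → Any (λ h → p ≈ₚ perm h) H-elements
    H-complete {p} p∈ = proj₁ (⟨⟩-preserves {U = λ q → Any (λ h → q ≈ₚ perm h) H-elements}
        (λ e → Any.map λ e′ i → trans (sym (e i)) (e′ i)) (λ {s} {q} → closed {s} {q}) p∈ {idP} H-ε)
      where
      shift : ∀ s {q} → All (λ h → Any (s ∙ h ≋_) H-elements) H-elements →
              Any (λ h → q ≈ₚ perm h) H-elements → Any (λ h → perm s · q ≈ₚ perm h) H-elements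
      shift s {q} s∙ q∈ = let h , h∈ , q≈h = find q∈ in
        Any.map (λ {h′} e → ≈-trans (λ i → q≈h _) (≋⇒≈ (s ∙ h) h′ e)) (All.lookup s∙ h∈)
      closed : ∀ {s q} → s ∈ hs → Any (λ h → q ≈ₚ perm h) H-elements →
               Any (λ h → s · q ≈ₚ perm h) H-elements × Any (λ h → s ⁻¹ · q ≈ₚ perm h) H-elements
      closed {s} {q} s∈ q∈ = let row = All.lookup H-closed (∈-map⁺ tab s∈) in
        shift (tab s) {q} (All.map proj₁ row) q∈ ,
        shift (inverse (tab s)) {q} (All.map proj₂ row) q∈
      ε∈subproducts : ∀ xs → ε {n} ∈ subproducts xs
      ε∈subproducts []       = here refl
      ε∈subproducts (x ∷ xs) = ∈-++⁺ˡ (ε∈subproducts xs)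
      H-ε : Any (λ h → idP ≈ₚ perm h) H-elements
      H-ε = lose (ε∈subproducts (map tab hs)) λ _ → refl

    ~-rep : ∀ {p k} → p ~ perm (rep k) →
            ∃ λ h → h ∈ H-elements × p ≈ₚ perm h · perm (rep k)
    ~-rep {p} {k} p~k = let h , h∈ , e = find (H-complete p~k) in
      h , h∈ , ≈-trans (~-elim p (perm (rep k)) p~k) λ i → cong (perm (rep k) ⟨$⟩ʳ_) (e i)

    rep-unique : ∀ {k l} → k < m → l < m → perm (rep k) ~ perm (rep l) → k ≡ l
    rep-unique {k} {l} k<m l<m k~l =
      let h , h∈ , e = ~-rep {perm (rep k)} {l} k~l in
      [ id , (λ apart → ⊥-elim (All.lookup apart h∈ (≈⇒≋ (rep k) (h ∙ rep l) e))) ]′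
      (allBelow (allBelow distinct k<m) l<m)

    -- Arbitrary `h` and `u` reduce to the finite check: `h · u` lies in the coset of `rep k`, so it
    -- is a listed element of `H` times `rep k`, and `steps⇒nbrs` has treated `x` times that
    -- product.
    neighbour : ∀ {u v k x h} → k < m → u ~ perm (rep k) → x ∈ connectors → ⟨ hs ⟩ h →
                v ~ perm x · (h · u) → ∃ λ l → l ∈ nbrs T k × v ~ perm (rep l)
    neighbour {u} {v} {k} {x} {h} k<m u~k x∈ h∈ v~ =
      let h₁ , h₁∈ , e₁ = ~-rep {h · u} {k} (~-trans (h · u) u (perm (rep k)) (·-~ u h∈) u~k)
          l , l∈ , found = find (All.lookup (All.lookup (allBelow steps⇒nbrs k<m) x∈) h₁∈)
          h₂ , h₂∈ , e₂ = find found in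
      l , l∈ , ~-trans v (perm x · (h · u)) (perm (rep l)) v~
        (~-intro (perm x · (h · u)) (perm (rep l)) (H-elements-⟨⟩ h₂∈)
          (≈-trans (λ i → e₁ (perm x ⟨$⟩ʳ i)) (≋⇒≈ (x ∙ (h₁ ∙ rep k)) (h₂ ∙ rep l) e₂)))

    Covered : Perm n → Set
    Covered p = ∃ λ k → k < m × p ~ perm (rep k)

    -- Coset enumeration: the union of the listed cosets contains the identity and is closed under
    -- left multiplication by generators and their inverses. Those from `hs` stay in the coset;
    -- those from `a` and `b` lead to a vertex in the same row of the table.
    cover : ∀ {p} → ⟨ gens ⟩ p → Covered p
    cover {p} p∈ = proj₁ (⟨⟩-preserves {U = Covered} (λ {p} {q} → resp {p} {q})
        (λ {s} {q} → closed {s} {q}) p∈ {idP}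
        (0 , nonempty , ≈⇒~ idP (perm (rep 0)) (≋⇒≈ ε (rep 0) (sym root))))
      where
      resp : ∀ {p q} → p ≈ₚ q → Covered p → Covered q
      resp {p} {q} e (k , k<m , p~k) =
        k , k<m , ~-trans q p (perm (rep k)) (≈⇒~ q p (sym ∘ e)) p~k
      connect : ∀ x {q} → x ∈ connectors → Covered q → Covered (perm x · q)
      connect x {q} x∈ (k , k<m , q~k) =
        let l , l∈ , e = neighbour {q} {perm x · q} {k} {x} {idP} k<m q~k x∈ ⟨⟩-ε
                           (≈⇒~ (perm x · q) (perm x · (idP · q)) λ _ → refl) in
        l , All.lookup (allBelow nbrs< k<m) l∈ , e
      closed : ∀ {s q} → s ∈ gens → Covered q → Covered (s · q) × Covered (s ⁻¹ · q)
      closed {s} {q} s∈ c@(k , k<m , q~k) =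
        [ (λ s∈hs → (k , k<m , ~-trans (s · q) q (perm (rep k)) (·-~ q (⟨⟩-∈ s∈hs)) q~k) ,
                    (k , k<m , ~-trans (s ⁻¹ · q) q (perm (rep k)) (·-~ q (⟨⟩-⁻¹ (⟨⟩-∈ s∈hs))) q~k))
        , closed-ab ]′ (∈-++⁻ hs s∈)
        where
        closed-ab : ∀ {s} → s ∈ a ∷ b ∷ [] → Covered (s · q) × Covered (s ⁻¹ · q)
        closed-ab (here refl) =
          connect (tab a) {q} (here refl) c , connect (inverse (tab a)) {q} (there (here refl)) c
        closed-ab (there (here refl)) =
          connect (tab b) {q} (there (there (here refl))) c ,
          connect (inverse (tab b)) {q} (there (there (there (here refl)))) c

    module CosetGraph {G : Perm n → Set}
                      (G⇒⟨gens⟩ : ∀ {p} → G p → ⟨ gens ⟩ p)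
                      (⟨gens⟩⇒G : ∀ {p} → ⟨ gens ⟩ p → G p) where

      Γ : Graph
      Γ = Cos G ⟨ hs ⟩ a b

      open Graph Γ

      neighbour-E : ∀ {u v : V} {k} → k < m → proj₁ u ~ perm (rep k) → E u v →
                    ∃ λ l → l ∈ nbrs T k × proj₁ v ~ perm (rep l)
      neighbour-E {u , _} {v , _} {k} k<m u~k (g , _ , d , dc , uv) =
        [ through (here refl) (there (here refl))
        , through (there (there (here refl))) (there (there (there (here refl)))) ]′ dc
        where
        through : ∀ {x} → tab x ∈ connectors → inverse (tab x) ∈ connectors → DC G ⟨ hs ⟩ x d →
                  ∃ λ l → l ∈ nbrs T k × v ~ perm (rep l)
        through {x} x∈ x⁻¹∈ (h₁ , h₂ , h₁∈ , h₂∈ , d≈) = case uv of λ where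
          (inj₁ (u~g , v~dg)) →
            -- As `d` is `h₁ · x · h₂`, this choice makes `x · (h · u)` equal to `x · h₂ · g`, which
            -- lies in the coset of `d · g`.
            let h = h₂ · (g · u ⁻¹) in
            neighbour {u} {v} {k} {tab x} {h} k<m u~k x∈ (⟨⟩-· h₂∈ (~-sym u g u~g))
              (~-trans v (d · g) (x · (h · u)) v~dg
                (~-intro (d · g) (x · (h · u)) h₁∈
                  λ i → trans (cong (g ⟨$⟩ʳ_) (d≈ i)) (sym (inverseʳ u))))
          (inj₂ (u~dg , v~g)) →
            -- Reading the edge backwards, `x ⁻¹ · (h · u)` becomes `h₂ · g`, which lies in the
            -- coset of `g`.
            let h = h₁ ⁻¹ · (d · g · u ⁻¹) in
            neighbour {u} {v} {k} {inverse (tab x)} {h} k<m u~k x⁻¹∈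
              (⟨⟩-· (⟨⟩-⁻¹ h₁∈) (~-sym u (d · g) u~dg))
              (~-trans v g (x ⁻¹ · (h · u)) v~g
                (~-trans g (h₂ · g) (x ⁻¹ · (h · u)) (~-sym (h₂ · g) g (·-~ g h₂∈))
                  (≈⇒~ (h₂ · g) (x ⁻¹ · (h · u)) λ i → sym (trans (inverseʳ u)
                    (cong (g ⟨$⟩ʳ_) (trans (d≈ _) (cong (h₂ ⟨$⟩ʳ_)
                      (trans (cong (x ⟨$⟩ʳ_) (inverseʳ h₁)) (inverseʳ x)))))))))

      edge : ∀ {u v : V} {k l} → k < m → proj₁ u ~ perm (rep k) → proj₁ v ~ perm (rep l) →
             l ∈ nbrs T k → E u v
      edge {u , _} {v , _} {k} {l} k<m u~k v~l l∈ =
        let x , x∈ , found  = find (All.lookup (allBelow nbrs⇒steps k<m) l∈)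
            h , h∈ , found′ = find found
            h′ , h′∈ , e    = find found′
            r = perm (rep k) ; d = perm x · perm h in
        r , ⟨gens⟩⇒G (reps-⟨⟩ k) , d , double-coset x h x∈ h∈ ,
        inj₁ (u~k , ~-trans v (perm (rep l)) (d · r) v~l
                      (~-intro (perm (rep l)) (d · r) (H-elements-⟨⟩ h′∈)
                        (≋⇒≈ (rep l) (h′ ∙ ((x ∙ h) ∙ rep k)) e)))
        where
        double-coset : ∀ x h → x ∈ tab a ∷ tab b ∷ [] → h ∈ H-elements →
                       DC G ⟨ hs ⟩ a (perm x · perm h) ⊎ DC G ⟨ hs ⟩ b (perm x · perm h)
        double-coset _ h (here refl)         h∈ =
          inj₁ (idP , perm h , ⟨⟩-ε , H-elements-⟨⟩ h∈ , λ _ → refl)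
        double-coset _ h (there (here refl)) h∈ =
          inj₂ (idP , perm h , ⟨⟩-ε , H-elements-⟨⟩ h∈ , λ _ → refl)

      -- The number is extracted from a derivation of membership in the generated group;
      -- `code-unique` shows that it depends only on the coset.
      code : V → ℕ
      code (_ , Gu) = proj₁ (cover (G⇒⟨gens⟩ Gu))

      code< : ∀ u → code u < m
      code< (_ , Gu) = proj₁ (proj₂ (cover (G⇒⟨gens⟩ Gu)))

      ~-code : ∀ u → proj₁ u ~ perm (rep (code u))
      ~-code (_ , Gu) = proj₂ (proj₂ (cover (G⇒⟨gens⟩ Gu)))

      code-unique : ∀ {u k} → k < m → proj₁ u ~ perm (rep k) → code u ≡ k
      code-unique {u} {k} k<m u~k = rep-unique (code< u) k<m
        (~-trans (perm (rep (code u))) (proj₁ u) (perm (rep k))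
          (~-sym (proj₁ u) (perm (rep (code u))) (~-code u)) u~k)

      presentation : Presentation Γ T
      presentation = record
        { nonempty = nonempty
        ; code     = code
        ; rep      = λ k → perm (rep k) , ⟨gens⟩⇒G (reps-⟨⟩ k)
        ; code<    = code<
        ; code-rep = λ {k} k<m → code-unique k<m (≈⇒~ (perm (rep k)) (perm (rep k)) λ _ → refl)
        ; ≃⇒code   = λ {u} {v} u~v → code-unique {u} (code< v)
            (~-trans (proj₁ u) (proj₁ v) (perm (rep (code v))) u~v (~-code v))
        ; code⇒≃   = λ {u} {v} eq → ~-trans (proj₁ u) (perm (rep (code v))) (proj₁ v)
            (subst (λ k → proj₁ u ~ perm (rep k)) eq (~-code u))
            (~-sym (proj₁ v) (perm (rep (code v))) (~-code v))
        ; E⇒nbr    = λ {u} {v} e →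
            let l , l∈ , v~l = neighbour-E {u} {v} (code< u) (~-code u) e in
            subst (_∈ nbrs T (code u))
              (sym (code-unique {v} (All.lookup (allBelow nbrs< (code< u)) l∈) v~l)) l∈
        ; nbr⇒E    = λ {u} {v} → edge {u} {v} (code< u) (~-code u) (~-code v)
        ; E-sym    = λ (g , Gg , d , dc , uv) → g , Gg , d , dc , swapEnds uv
        }
        where
        swapEnds : ∀ {A B C D : Set} → (A × B) ⊎ (C × D) → (D × C) ⊎ (B × A)
        swapEnds = [ (λ (x , y) → inj₂ (y , x)) , (λ (x , y) → inj₁ (y , x)) ]′

      open Presentation presentation using (E-cong)

      G-· : ∀ {p q} → G p → G q → G (p · q)
      G-· Gp Gq = ⟨gens⟩⇒G (⟨⟩-· (G⇒⟨gens⟩ Gp) (G⇒⟨gens⟩ Gq))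

      G-⁻¹ : ∀ {p} → G p → G (p ⁻¹)
      G-⁻¹ Gp = ⟨gens⟩⇒G (⟨⟩-⁻¹ (G⇒⟨gens⟩ Gp))

      translate : ∀ {x} → G x → V → V
      translate {x} Gx (u , Gu) = u · x , G-· Gu Gx

      translate-E : ∀ {x} (Gx : G x) {u v} → E u v → E (translate Gx u) (translate Gx v)
      translate-E {x} Gx {u , _} {v , _} (g , Gg , d , dc , uv) =
        g · x , G-· Gg Gx , d , dc , [ (λ (p , q) → inj₁ (near u p , far v q))
                                     , (λ (p , q) → inj₂ (far u p , near v q)) ]′ uv
        where
        near : ∀ w → w ~ g → w · x ~ g · x
        near w = ~-·ʳ w g x
        far : ∀ w → w ~ d · g → w · x ~ d · (g · x)
        far w w~dg = ⟨⟩-resp (λ _ → refl) (~-·ʳ w (d · g) x w~dg)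

      cancel : ∀ u x → u · x · x ⁻¹ ~ u
      cancel u x = ≈⇒~ (u · x · x ⁻¹) u λ _ → inverseˡ x

      translation : ∀ {x} → G x → Aut Γ
      translation {x} Gx = record
        { to        = translate Gx
        ; from      = translate (G-⁻¹ Gx)
        ; to-cong   = λ {u} {v} → ~-·ʳ (proj₁ u) (proj₁ v) x
        ; from-cong = λ {u} {v} → ~-·ʳ (proj₁ u) (proj₁ v) (x ⁻¹)
        ; to-from   = λ (v , _) → ≈⇒~ (v · x ⁻¹ · x) v λ _ → inverseʳ x
        ; from-to   = λ (v , _) → cancel v x
        ; hom       = λ u v → translate-E Gx {u} {v}
        ; hom⁻      = λ u v e → E-cong
            {translate (G-⁻¹ Gx) (translate Gx u)} {u} {translate (G-⁻¹ Gx) (translate Gx v)} {v}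
            (cancel (proj₁ u) x) (cancel (proj₁ v) x)
            (translate-E (G-⁻¹ Gx) {translate Gx u} {translate Gx v} e)
        }

      vertexTransitive : VertexTransitive Γ
      vertexTransitive (u , Gu) (v , Gv) =
        translation (G-· (G-⁻¹ Gu) Gv) ,
        ≈⇒~ (u · (u ⁻¹ · v)) v λ _ → cong (v ⟨$⟩ʳ_) (inverseˡ u)

      ActsAs : Aut Γ → Perm n → Set
      ActsAs χ x = ∀ w → proj₁ (to χ w) ~ proj₁ w · x

      -- Each x in X is a commutator of two elements of X, so translations by X survive in every
      -- term of a solvable series.
      notSolvable : ∀ xs → Perfect H-elements (elements xs) → ¬ SolvableAut Γ
      notSolvable xs (commutators , outside)
                  (length , S , S-all , _ , _ , _ , S-commutator , S-trivial) =
        let x , x∈ , x∉H = find outside in nontrivial x x∈ x∉H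
        where
        G-X : ∀ {x} → x ∈ elements xs → G (perm x)
        G-X x∈ = ⟨gens⟩⇒G (elements-⟨⟩ xs x∈)

        -- The terms of a series are predicates that need not respect pointwise equality, so the
        -- induction speaks of every automorphism that acts like `x`, as `S-commutator` does in its
        -- conclusion.
        Contains : ℕ → Perm n → Set
        Contains i x = ∀ χ → ActsAs χ x → S i χ

        translation∈ : ∀ i x (Gx : G x) → Contains i x → S i (translation Gx)
        translation∈ i x Gx contains =
          contains (translation Gx) λ w → ≈⇒~ (proj₁ w · x) (proj₁ w · x) λ _ → refl

        commutator∈ : ∀ i {x y z} → G y → G z → x ≈ₚ y ⁻¹ · z ⁻¹ · y · z →
                      Contains i y → Contains i z → Contains (suc i) x
        commutator∈ i {x} {y} {z} Gy Gz e Sy Sz χ χ~x =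
          S-commutator i (translation Gy) (translation Gz)
            (translation∈ i y Gy Sy) (translation∈ i z Gz Sz) χ λ w →
              ~-trans (proj₁ (to χ w)) (proj₁ w · x) (proj₁ w · y ⁻¹ · z ⁻¹ · y · z) (χ~x w)
                (≈⇒~ (proj₁ w · x) (proj₁ w · y ⁻¹ · z ⁻¹ · y · z) λ i → e (proj₁ w ⟨$⟩ʳ i))

        survives : ∀ i {x} → x ∈ elements xs → Contains i (perm x)
        survives zero    _      = λ χ _ → S-all χ
        survives (suc i) {x} x∈ =
          let y , y∈ , found = find (All.lookup commutators x∈)
              z , z∈ , e     = find found in
          commutator∈ i {perm x} {perm y} {perm z} (G-X y∈) (G-X z∈)
            (≋⇒≈ x (inverse y ∙ inverse z ∙ y ∙ z) e) (survives i y∈) (survives i z∈)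

        nontrivial : ∀ x → x ∈ elements xs → All (λ h → ¬ (x ≋ h)) H-elements → ⊥
        nontrivial x x∈ x∉H =
          -- Evaluated at the vertex `H`, triviality of the translation puts `x` into `H`.
          let h , h∈ , x≈h = find (H-complete {perm x} (⟨⟩-resp (λ _ → refl)
                (S-trivial (translation (G-X x∈))
                  (translation∈ length (perm x) (G-X x∈) (survives length x∈))
                  (idP , ⟨gens⟩⇒G ⟨⟩-ε)))) in
          All.lookup x∉H h∈ (≈⇒≋ x h x≈h)

      facts : ∀ c p q xs → does (certificate? T c p q) ≡ true →
              does (perfect? H-elements (elements xs)) ≡ true → Facts Γ T
      facts c p q xs certified perfect = record
        { presentation     = presentation
        ; connected        = Properties.isConnected presentation C
        ; cubic            = Properties.isCubic presentation C
        ; vertexTransitive = vertexTransitive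
        ; notSymmetric     = Properties.isNotSymmetric presentation C
        ; notCayley        = Properties.isNotCayley presentation C
        ; notSolvable      = notSolvable xs (decided (perfect? _ _) perfect)
        }
        where C = decided (certificate? T c p q) certified

-- Identifying the generated group with the prescribed one

arrangements : ∀ {n} k → List (Fin n) → List (Vec (Fin n) k)
arrangements zero    used = []ᵛ ∷ []
arrangements (suc k) used =
  concatMap (λ x → map (x ∷ᵛ_) (arrangements k (x ∷ used)))
    (filter (λ x → ¬? (x ∈ᶠ? used)) (allFin _))

-- Permutations are injective, so their values form an arrangement; a claim about all of them
-- becomes a finite check.
arrangements-complete : ∀ {n} k {used} (f : Fin k → Fin n) → (∀ {i j} → f i ≡ f j → i ≡ j) →
                        (∀ i → f i ∉ used) → tabulate f ∈ arrangements k used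
arrangements-complete zero    f inj avoids = here refl
arrangements-complete {n} (suc k) {used} f inj avoids =
  ∈-concatMap⁺ (λ x → map (x ∷ᵛ_) (arrangements k (x ∷ used)))
    (lose (∈-filter⁺ (λ x → ¬? (x ∈ᶠ? used)) (∈-allFin (f zero)) (avoids zero))
      (∈-map⁺ (f zero ∷ᵛ_) (arrangements-complete k (f ∘ suc) (F.suc-injective ∘ inj) avoids′)))
  where
  avoids′ : ∀ i → f (suc i) ∉ f zero ∷ used
  avoids′ i (here eq)  = case inj eq of λ ()
  avoids′ i (there f∈) = avoids (suc i) f∈

perm-injective : ∀ {n} (p : Perm n) {i j} → p ⟨$⟩ʳ i ≡ p ⟨$⟩ʳ j → i ≡ j
perm-injective p eq = trans (sym (inverseˡ p)) (trans (cong (p ⟨$⟩ˡ_) eq) (inverseˡ p))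

-- Agrees definitionally with inversions, but applies to tabulated values.
inversionsOf : ∀ {n} → (Fin n → Fin n) → ℕ
inversionsOf {n} f =
  length (filter (λ ij → f (proj₂ ij) F<? f (proj₁ ij))
                 (filter (λ ij → proj₁ ij F<? proj₂ ij) (cartesianProduct (allFin n) (allFin n))))

inversionsOf-cong : ∀ {n} {f g : Fin n → Fin n} → (∀ i → f i ≡ g i) →
                    inversionsOf f ≡ inversionsOf g
inversionsOf-cong {n} {f} {g} e = cong length
  (filter-≐ (λ ij → f (proj₂ ij) F<? f (proj₁ ij)) (λ ij → g (proj₂ ij) F<? g (proj₁ ij))
    ((λ {ij} → subst₂ _F<_ (e (proj₂ ij)) (e (proj₁ ij))) ,
     (λ {ij} → subst₂ _F<_ (sym (e (proj₂ ij))) (sym (e (proj₁ ij)))))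
    (filter (λ ij → proj₁ ij F<? proj₂ ij) (cartesianProduct (allFin n) (allFin n))))

isEven? : ∀ m → Dec (isEven m)
isEven? m = map′ (⌊ m /2⌋ ,_) (λ (k , m≡2k) → subst (λ m → m ≡ ⌊ m /2⌋ + ⌊ m /2⌋) (sym m≡2k)
                                                  (cong₂ _+_ (n≡⌊n+n/2⌋ k) (n≡⌊n+n/2⌋ k)))
                 (m ≟ ⌊ m /2⌋ + ⌊ m /2⌋)

-- The first factor of a product with ⟨(6 7)⟩, as a property of functions in order to be decided
-- on tabulated values.
record Property : Set₁ where
  field
    Q    : (Fin 7 → Fin 7) → Set
    Q?   : ∀ f → Dec (Q f)
    resp : ∀ {f g} → (∀ i → f i ≡ g i) → Q f → Q g
    fix5 : ∀ {f} → Q f → f (# 5) ≡ # 5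
    fix6 : ∀ {f} → Q f → f (# 6) ≡ # 6

  Product : Perm 7 → Set
  Product = (λ p → Q (p ⟨$⟩ʳ_)) ⊗ ⟨ t67 ∷ [] ⟩

symmetric alternating : Property
symmetric = record
  { Q    = λ f → f (# 5) ≡ # 5 × f (# 6) ≡ # 6
  ; Q?   = λ f → (f (# 5) F.≟ # 5) ×-dec (f (# 6) F.≟ # 6)
  ; resp = λ e (p , q) → trans (sym (e _)) p , trans (sym (e _)) q
  ; fix5 = proj₁
  ; fix6 = proj₂
  }
alternating = record
  { Q    = λ f → (f (# 5) ≡ # 5 × f (# 6) ≡ # 6) × isEven (inversionsOf f)
  ; Q?   = λ f → ((f (# 5) F.≟ # 5) ×-dec (f (# 6) F.≟ # 6)) ×-dec isEven? (inversionsOf f)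
  ; resp = λ e ((p , q) , even) → (trans (sym (e _)) p , trans (sym (e _)) q) ,
                                  subst isEven (inversionsOf-cong e) even
  ; fix5 = proj₁ ∘ proj₁
  ; fix6 = proj₂ ∘ proj₁
  }

module Sym₅ (hs : List (Perm 5)) (a b : Perm 5) (tree : List (ℕ × ℕ)) (T : Table) where
  open CosetTable hs a b tree T

  exhausted? : ∀ group → Dec (All (Listed group) (arrangements 5 []))
  exhausted? group = All.all? (listed? group) _

  module _ (exhausted : does (exhausted? group) ≡ true) where

    -- All 120 arrangements of five points occur among the products of `H` with the representatives.
    Sym⇒⟨gens⟩ : ∀ {p} → Sym 5 p → ⟨ gens ⟩ p
    Sym⇒⟨gens⟩ {p} _ = listed⇒⟨⟩ {p} (lookup∘tabulate (p ⟨$⟩ʳ_))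
      (All.lookup (decided (exhausted? group) exhausted)
        (arrangements-complete 5 {[]} (p ⟨$⟩ʳ_) (perm-injective p) λ _ ()))

    symFacts : Validated → ∀ c p q xs → does (certificate? T c p q) ≡ true →
               does (perfect? H-elements (elements xs)) ≡ true → Facts (Cos (Sym 5) ⟨ hs ⟩ a b) T
    symFacts validated =
      Cosets.CosetGraph.facts validated (λ {p} → Sym⇒⟨gens⟩ {p}) λ _ → tt

module ProductWithZ₂ (property : Property) (hs : List (Perm 7)) (a b : Perm 7)
                     (tree : List (ℕ × ℕ)) (T : Table) where
  open Property property
  open CosetTable hs a b tree T

  extended : Vec (Fin 7) 5 → Vec (Fin 7) 7
  extended v = v ++ᵛ # 5 ∷ᵛ # 6 ∷ᵛ []ᵛ

  -- `t67-listed` and `Q-listed` put both factors into the generated group. Conversely, `gens⇒Q`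
  -- splits each generated element into a part satisfying `Q` and a power of `t67`, its second
  -- alternative being the nontrivial power.
  record Identified (H reps group : List (Tabulated 7)) : Set where
    field
      t67-listed : Listed group (vals (tab t67))
      Q-listed   : All (λ v → Q (lookup (extended v)) → Listed group (extended v))
                     (arrangements 5 (# 5 ∷ # 6 ∷ []))
      gens⇒Q     : All (λ k → All (λ h → Q (lookup (vals (h ∙ nth ε reps k))) ⊎
                     Q (lookup (vals (h ∙ nth ε reps k ∙ tab t67)))) H) (upTo m)

  identified? : ∀ H reps group → Dec (Identified H reps group)
  identified? H reps group = map′
    (λ (a , b , c) → record { t67-listed = a ; Q-listed = b ; gens⇒Q = c })
    (λ i → let open Identified i in t67-listed , Q-listed , gens⇒Q)
    (listed? group _ ×-dec All.all? (λ v → Q? _ →-dec listed? group _) _ ×-dec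
     All.all? (λ k → All.all? (λ h → Q? _ ⊎-dec Q? _) H) _)

  module _ (identified : does (identified? H-elements reps group) ≡ true)
           (validated : Validated) where
    open Identified (decided (identified? H-elements reps group) identified)
    open Cosets validated

    Q⇒⟨gens⟩ : ∀ {p} → Q (p ⟨$⟩ʳ_) → ⟨ gens ⟩ p
    Q⇒⟨gens⟩ {p} Qp = listed⇒⟨⟩ {p} v≡p
        (All.lookup Q-listed
          (arrangements-complete 5 {# 5 ∷ # 6 ∷ []} f
            (F.↑ˡ-injective 2 _ _ ∘ perm-injective p) avoids)
          (resp (sym ∘ v≡p) Qp))
      where
      f : Fin 5 → Fin 7
      f i = p ⟨$⟩ʳ (i ↑ˡ 2)
      low≢ : ∀ i → i ↑ˡ 2 ≢ # 5 × i ↑ˡ 2 ≢ # 6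
      low≢ = decided (F.all? λ i → ¬? (i ↑ˡ 2 F.≟ # 5) ×-dec ¬? (i ↑ˡ 2 F.≟ # 6)) refl
      avoids : ∀ i → f i ∉ # 5 ∷ # 6 ∷ []
      avoids i (here eq)         = proj₁ (low≢ i) (perm-injective p (trans eq (sym (fix5 Qp))))
      avoids i (there (here eq)) = proj₂ (low≢ i) (perm-injective p (trans eq (sym (fix6 Qp))))
      v≡p : ∀ i → lookup (extended (tabulate f)) i ≡ p ⟨$⟩ʳ i
      v≡p zero                                     = refl
      v≡p (suc zero)                               = refl
      v≡p (suc (suc zero))                         = refl
      v≡p (suc (suc (suc zero)))                   = refl
      v≡p (suc (suc (suc (suc zero))))             = refl
      v≡p (suc (suc (suc (suc (suc zero)))))       = sym (fix5 Qp)
      v≡p (suc (suc (suc (suc (suc (suc zero)))))) = sym (fix6 Qp)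

    Product⇒⟨gens⟩ : ∀ {p} → Product p → ⟨ gens ⟩ p
    Product⇒⟨gens⟩ (x , y , Qx , y∈ , p≈xy) = mul (Q⇒⟨gens⟩ {x} Qx) (⟨⟩-least t67∈ y∈) p≈xy
      where
      t67∈ : ∀ {s} → s ∈ t67 ∷ [] → ⟨ gens ⟩ s
      t67∈ (here refl) = listed⇒⟨⟩ {t67} (agrees (tab t67)) t67-listed

    ⟨gens⟩⇒Product : ∀ {p} → ⟨ gens ⟩ p → Product p
    ⟨gens⟩⇒Product {p} p∈ =
      let k , k<m , p~k  = cover p∈
          h , h∈ , p≈hk = ~-rep {p} {k} p~k in
      case All.lookup (allBelow gens⇒Q k<m) h∈ of λ where
        (inj₁ Qp)  → p , idP ,
          resp (λ i → trans (agrees (h ∙ rep k) i) (sym (p≈hk i))) Qp ,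
          one (λ _ → refl) , λ _ → refl
        (inj₂ Qpt) → p · t67 , t67 ⁻¹ ,
          resp (λ i → trans (agrees (h ∙ rep k ∙ tab t67) i)
                            (cong (t67 ⟨$⟩ʳ_) (sym (p≈hk i)))) Qpt ,
          ⟨⟩-⁻¹ (⟨⟩-∈ (here refl)) , λ _ → sym (inverseˡ t67)

    productFacts : ∀ c p q xs → does (certificate? T c p q) ≡ true →
                   does (perfect? H-elements (elements xs)) ≡ true →
                   Facts (Cos Product ⟨ hs ⟩ a b) T
    productFacts = CosetGraph.facts Product⇒⟨gens⟩ ⟨gens⟩⇒Product

-- Vertex k is the coset of the k-th element that grow finds from the tree.  The vertices are
-- numbered so that short cycles close early, which keeps the backtracking small.
T0 : Table
T0 =
  (1 , 4 , 5) ∷ (0 , 2 , 21) ∷ (1 , 3 , 52) ∷ (2 , 4 , 47) ∷ (0 , 3 , 10) ∷ (0 , 6 , 14) ∷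
  (5 , 7 , 16) ∷ (6 , 8 , 27) ∷ (7 , 9 , 22) ∷ (8 , 10 , 11) ∷ (4 , 9 , 13) ∷ (9 , 12 , 19) ∷
  (11 , 13 , 35) ∷ (10 , 12 , 42) ∷ (5 , 15 , 17) ∷ (14 , 16 , 41) ∷ (6 , 15 , 38) ∷
  (14 , 18 , 28) ∷ (17 , 19 , 20) ∷ (11 , 18 , 29) ∷ (18 , 21 , 23) ∷ (1 , 20 , 24) ∷
  (8 , 23 , 26) ∷ (20 , 22 , 25) ∷ (21 , 25 , 53) ∷ (23 , 24 , 33) ∷ (22 , 27 , 32) ∷
  (7 , 26 , 45) ∷ (17 , 29 , 49) ∷ (19 , 28 , 30) ∷ (29 , 31 , 36) ∷ (30 , 32 , 34) ∷
  (26 , 31 , 37) ∷ (25 , 34 , 57) ∷ (31 , 33 , 35) ∷ (12 , 34 , 59) ∷ (30 , 37 , 39) ∷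
  (32 , 36 , 40) ∷ (16 , 39 , 43) ∷ (36 , 38 , 44) ∷ (37 , 41 , 54) ∷ (15 , 40 , 51) ∷
  (13 , 43 , 44) ∷ (38 , 42 , 46) ∷ (39 , 42 , 48) ∷ (27 , 46 , 55) ∷ (43 , 45 , 47) ∷
  (3 , 46 , 56) ∷ (44 , 49 , 58) ∷ (28 , 48 , 50) ∷ (49 , 51 , 52) ∷ (41 , 50 , 53) ∷
  (2 , 50 , 58) ∷ (24 , 51 , 54) ∷ (40 , 53 , 55) ∷ (45 , 54 , 56) ∷ (47 , 55 , 57) ∷
  (33 , 56 , 59) ∷ (48 , 52 , 59) ∷ (35 , 57 , 58) ∷ []

T1 : Table
T1 =
  (1 , 5 , 24) ∷ (0 , 2 , 43) ∷ (1 , 3 , 14) ∷ (2 , 4 , 18) ∷ (3 , 5 , 9) ∷ (0 , 4 , 6) ∷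
  (5 , 7 , 10) ∷ (6 , 8 , 13) ∷ (7 , 9 , 39) ∷ (4 , 8 , 57) ∷ (6 , 11 , 41) ∷ (10 , 12 , 56) ∷
  (11 , 13 , 15) ∷ (7 , 12 , 17) ∷ (2 , 15 , 16) ∷ (12 , 14 , 19) ∷ (14 , 17 , 29) ∷
  (13 , 16 , 27) ∷ (3 , 19 , 23) ∷ (15 , 18 , 20) ∷ (19 , 21 , 31) ∷ (20 , 22 , 25) ∷
  (21 , 23 , 26) ∷ (18 , 22 , 33) ∷ (0 , 25 , 30) ∷ (21 , 24 , 42) ∷ (22 , 27 , 28) ∷
  (17 , 26 , 32) ∷ (26 , 29 , 40) ∷ (16 , 28 , 49) ∷ (24 , 31 , 34) ∷ (20 , 30 , 37) ∷
  (27 , 33 , 35) ∷ (23 , 32 , 46) ∷ (30 , 35 , 47) ∷ (32 , 34 , 36) ∷ (35 , 37 , 38) ∷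
  (31 , 36 , 53) ∷ (36 , 39 , 45) ∷ (8 , 38 , 44) ∷ (28 , 41 , 59) ∷ (10 , 40 , 48) ∷
  (25 , 43 , 44) ∷ (1 , 42 , 45) ∷ (39 , 42 , 58) ∷ (38 , 43 , 52) ∷ (33 , 47 , 51) ∷
  (34 , 46 , 48) ∷ (41 , 47 , 49) ∷ (29 , 48 , 50) ∷ (49 , 51 , 52) ∷ (46 , 50 , 55) ∷
  (45 , 50 , 53) ∷ (37 , 52 , 54) ∷ (53 , 55 , 56) ∷ (51 , 54 , 57) ∷ (11 , 54 , 59) ∷
  (9 , 55 , 58) ∷ (44 , 57 , 59) ∷ (40 , 56 , 58) ∷ []

T2 : Table
T2 =
  (1 , 4 , 5) ∷ (0 , 2 , 38) ∷ (1 , 3 , 11) ∷ (2 , 4 , 19) ∷ (0 , 3 , 57) ∷ (0 , 6 , 29) ∷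
  (5 , 7 , 31) ∷ (6 , 8 , 13) ∷ (7 , 9 , 45) ∷ (8 , 10 , 12) ∷ (9 , 11 , 16) ∷ (2 , 10 , 14) ∷
  (9 , 13 , 55) ∷ (7 , 12 , 17) ∷ (11 , 15 , 32) ∷ (14 , 16 , 23) ∷ (10 , 15 , 26) ∷
  (13 , 18 , 20) ∷ (17 , 19 , 24) ∷ (3 , 18 , 21) ∷ (17 , 21 , 22) ∷ (19 , 20 , 35) ∷
  (20 , 23 , 36) ∷ (15 , 22 , 39) ∷ (18 , 25 , 27) ∷ (24 , 26 , 42) ∷ (16 , 25 , 28) ∷
  (24 , 28 , 47) ∷ (26 , 27 , 29) ∷ (5 , 28 , 30) ∷ (29 , 31 , 34) ∷ (6 , 30 , 33) ∷
  (14 , 33 , 53) ∷ (31 , 32 , 44) ∷ (30 , 35 , 48) ∷ (21 , 34 , 50) ∷ (22 , 37 , 40) ∷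
  (36 , 38 , 43) ∷ (1 , 37 , 41) ∷ (23 , 40 , 58) ∷ (36 , 39 , 46) ∷ (38 , 42 , 49) ∷
  (25 , 41 , 43) ∷ (37 , 42 , 44) ∷ (33 , 43 , 54) ∷ (8 , 46 , 51) ∷ (40 , 45 , 47) ∷
  (27 , 46 , 52) ∷ (34 , 49 , 59) ∷ (41 , 48 , 50) ∷ (35 , 49 , 51) ∷ (45 , 50 , 52) ∷
  (47 , 51 , 53) ∷ (32 , 52 , 54) ∷ (44 , 53 , 56) ∷ (12 , 56 , 59) ∷ (54 , 55 , 57) ∷
  (4 , 56 , 58) ∷ (39 , 57 , 59) ∷ (48 , 55 , 58) ∷ []

T3 : Table
T3 =
  (1 , 8 , 55) ∷ (0 , 2 , 25) ∷ (1 , 3 , 9) ∷ (2 , 4 , 13) ∷ (3 , 5 , 51) ∷ (4 , 6 , 16) ∷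
  (5 , 7 , 33) ∷ (6 , 8 , 12) ∷ (0 , 7 , 20) ∷ (2 , 10 , 19) ∷ (9 , 11 , 50) ∷ (10 , 12 , 28) ∷
  (7 , 11 , 15) ∷ (3 , 14 , 39) ∷ (13 , 15 , 22) ∷ (12 , 14 , 31) ∷ (5 , 17 , 40) ∷
  (16 , 18 , 24) ∷ (17 , 19 , 21) ∷ (9 , 18 , 37) ∷ (8 , 21 , 44) ∷ (18 , 20 , 30) ∷
  (14 , 23 , 36) ∷ (22 , 24 , 26) ∷ (17 , 23 , 57) ∷ (1 , 26 , 42) ∷ (23 , 25 , 27) ∷
  (26 , 28 , 29) ∷ (11 , 27 , 53) ∷ (27 , 30 , 34) ∷ (21 , 29 , 32) ∷ (15 , 32 , 41) ∷
  (30 , 31 , 59) ∷ (6 , 34 , 35) ∷ (29 , 33 , 38) ∷ (33 , 36 , 37) ∷ (22 , 35 , 48) ∷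
  (19 , 35 , 46) ∷ (34 , 39 , 56) ∷ (13 , 38 , 43) ∷ (16 , 41 , 49) ∷ (31 , 40 , 42) ∷
  (25 , 41 , 45) ∷ (39 , 44 , 45) ∷ (20 , 43 , 47) ∷ (42 , 43 , 46) ∷ (37 , 45 , 52) ∷
  (44 , 48 , 50) ∷ (36 , 47 , 49) ∷ (40 , 48 , 54) ∷ (10 , 47 , 58) ∷ (4 , 52 , 59) ∷
  (46 , 51 , 53) ∷ (28 , 52 , 54) ∷ (49 , 53 , 55) ∷ (0 , 54 , 56) ∷ (38 , 55 , 57) ∷
  (24 , 56 , 58) ∷ (50 , 57 , 59) ∷ (32 , 51 , 58) ∷ []

T4 : Table
T4 =
  (1 , 2 , 3) ∷ (0 , 2 , 45) ∷ (0 , 1 , 12) ∷ (0 , 4 , 17) ∷ (3 , 5 , 17) ∷ (4 , 6 , 16) ∷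
  (5 , 7 , 16) ∷ (6 , 8 , 15) ∷ (7 , 9 , 15) ∷ (8 , 10 , 14) ∷ (9 , 11 , 14) ∷ (10 , 12 , 13) ∷
  (2 , 11 , 13) ∷ (11 , 12 , 18) ∷ (9 , 10 , 35) ∷ (7 , 8 , 23) ∷ (5 , 6 , 59) ∷ (3 , 4 , 27) ∷
  (13 , 19 , 25) ∷ (18 , 20 , 25) ∷ (19 , 21 , 26) ∷ (20 , 22 , 26) ∷ (21 , 23 , 24) ∷
  (15 , 22 , 24) ∷ (22 , 23 , 40) ∷ (18 , 19 , 30) ∷ (20 , 21 , 28) ∷ (17 , 28 , 29) ∷
  (26 , 27 , 29) ∷ (27 , 28 , 48) ∷ (25 , 31 , 38) ∷ (30 , 32 , 38) ∷ (31 , 33 , 37) ∷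
  (32 , 34 , 37) ∷ (33 , 35 , 36) ∷ (14 , 34 , 36) ∷ (34 , 35 , 52) ∷ (32 , 33 , 39) ∷
  (30 , 31 , 42) ∷ (37 , 40 , 41) ∷ (24 , 39 , 41) ∷ (39 , 40 , 54) ∷ (38 , 43 , 46) ∷
  (42 , 44 , 46) ∷ (43 , 45 , 47) ∷ (1 , 44 , 47) ∷ (42 , 43 , 49) ∷ (44 , 45 , 51) ∷
  (29 , 49 , 50) ∷ (46 , 48 , 50) ∷ (48 , 49 , 55) ∷ (47 , 52 , 53) ∷ (36 , 51 , 53) ∷
  (51 , 52 , 57) ∷ (41 , 55 , 56) ∷ (50 , 54 , 56) ∷ (54 , 55 , 58) ∷ (53 , 58 , 59) ∷
  (56 , 57 , 59) ∷ (16 , 57 , 58) ∷ []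

T5 : Table
T5 =
  (1 , 5 , 6) ∷ (0 , 2 , 18) ∷ (1 , 3 , 35) ∷ (2 , 4 , 9) ∷ (3 , 5 , 21) ∷ (0 , 4 , 37) ∷
  (0 , 7 , 10) ∷ (6 , 8 , 12) ∷ (7 , 9 , 59) ∷ (3 , 8 , 11) ∷ (6 , 11 , 55) ∷ (9 , 10 , 15) ∷
  (7 , 13 , 16) ∷ (12 , 14 , 22) ∷ (13 , 15 , 30) ∷ (11 , 14 , 17) ∷ (12 , 17 , 33) ∷
  (15 , 16 , 24) ∷ (1 , 19 , 27) ∷ (18 , 20 , 44) ∷ (19 , 21 , 23) ∷ (4 , 20 , 26) ∷
  (13 , 23 , 29) ∷ (20 , 22 , 25) ∷ (17 , 25 , 28) ∷ (23 , 24 , 43) ∷ (21 , 27 , 40) ∷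
  (18 , 26 , 28) ∷ (24 , 27 , 29) ∷ (22 , 28 , 39) ∷ (14 , 31 , 48) ∷ (30 , 32 , 41) ∷
  (31 , 33 , 34) ∷ (16 , 32 , 51) ∷ (32 , 35 , 36) ∷ (2 , 34 , 47) ∷ (34 , 37 , 38) ∷
  (5 , 36 , 46) ∷ (36 , 39 , 42) ∷ (29 , 38 , 50) ∷ (26 , 41 , 53) ∷ (31 , 40 , 45) ∷
  (38 , 43 , 58) ∷ (25 , 42 , 49) ∷ (19 , 45 , 52) ∷ (41 , 44 , 57) ∷ (37 , 47 , 48) ∷
  (35 , 46 , 49) ∷ (30 , 46 , 51) ∷ (43 , 47 , 50) ∷ (39 , 49 , 54) ∷ (33 , 48 , 52) ∷
  (44 , 51 , 53) ∷ (40 , 52 , 56) ∷ (50 , 55 , 57) ∷ (10 , 54 , 56) ∷ (53 , 55 , 58) ∷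
  (45 , 54 , 59) ∷ (42 , 56 , 59) ∷ (8 , 57 , 58) ∷ []

T6 : Table
T6 =
  (1 , 5 , 6) ∷ (0 , 2 , 18) ∷ (1 , 3 , 37) ∷ (2 , 4 , 9) ∷ (3 , 5 , 21) ∷ (0 , 4 , 35) ∷
  (0 , 7 , 10) ∷ (6 , 8 , 12) ∷ (7 , 9 , 58) ∷ (3 , 8 , 11) ∷ (6 , 11 , 55) ∷ (9 , 10 , 15) ∷
  (7 , 13 , 16) ∷ (12 , 14 , 24) ∷ (13 , 15 , 30) ∷ (11 , 14 , 17) ∷ (12 , 17 , 33) ∷
  (15 , 16 , 22) ∷ (1 , 19 , 27) ∷ (18 , 20 , 44) ∷ (19 , 21 , 23) ∷ (4 , 20 , 26) ∷
  (17 , 23 , 29) ∷ (20 , 22 , 25) ∷ (13 , 25 , 28) ∷ (23 , 24 , 43) ∷ (21 , 27 , 40) ∷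
  (18 , 26 , 28) ∷ (24 , 27 , 29) ∷ (22 , 28 , 39) ∷ (14 , 31 , 48) ∷ (30 , 32 , 41) ∷
  (31 , 33 , 34) ∷ (16 , 32 , 51) ∷ (32 , 35 , 36) ∷ (5 , 34 , 47) ∷ (34 , 37 , 38) ∷
  (2 , 36 , 46) ∷ (36 , 39 , 42) ∷ (29 , 38 , 50) ∷ (26 , 41 , 53) ∷ (31 , 40 , 45) ∷
  (38 , 43 , 59) ∷ (25 , 42 , 49) ∷ (19 , 45 , 52) ∷ (41 , 44 , 57) ∷ (37 , 47 , 48) ∷
  (35 , 46 , 49) ∷ (30 , 46 , 51) ∷ (43 , 47 , 50) ∷ (39 , 49 , 54) ∷ (33 , 48 , 52) ∷
  (44 , 51 , 53) ∷ (40 , 52 , 56) ∷ (50 , 55 , 56) ∷ (10 , 54 , 57) ∷ (53 , 54 , 58) ∷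
  (45 , 55 , 59) ∷ (8 , 56 , 59) ∷ (42 , 57 , 58) ∷ []

T7 : Table
T7 =
  (1 , 2 , 3) ∷ (0 , 2 , 39) ∷ (0 , 1 , 14) ∷ (0 , 4 , 16) ∷ (3 , 5 , 16) ∷ (4 , 6 , 18) ∷
  (5 , 7 , 18) ∷ (6 , 8 , 17) ∷ (7 , 9 , 17) ∷ (8 , 10 , 15) ∷ (9 , 11 , 15) ∷ (10 , 12 , 20) ∷
  (11 , 13 , 20) ∷ (12 , 14 , 19) ∷ (2 , 13 , 19) ∷ (9 , 10 , 28) ∷ (3 , 4 , 21) ∷
  (7 , 8 , 48) ∷ (5 , 6 , 69) ∷ (13 , 14 , 83) ∷ (11 , 12 , 36) ∷ (16 , 22 , 31) ∷
  (21 , 23 , 31) ∷ (22 , 24 , 29) ∷ (23 , 25 , 29) ∷ (24 , 26 , 32) ∷ (25 , 27 , 32) ∷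
  (26 , 28 , 30) ∷ (15 , 27 , 30) ∷ (23 , 24 , 33) ∷ (27 , 28 , 66) ∷ (21 , 22 , 61) ∷
  (25 , 26 , 42) ∷ (29 , 34 , 38) ∷ (33 , 35 , 38) ∷ (34 , 36 , 37) ∷ (20 , 35 , 37) ∷
  (35 , 36 , 54) ∷ (33 , 34 , 72) ∷ (1 , 40 , 43) ∷ (39 , 41 , 43) ∷ (40 , 42 , 44) ∷
  (32 , 41 , 44) ∷ (39 , 40 , 57) ∷ (41 , 42 , 45) ∷ (44 , 46 , 49) ∷ (45 , 47 , 49) ∷
  (46 , 48 , 50) ∷ (17 , 47 , 50) ∷ (45 , 46 , 78) ∷ (47 , 48 , 51) ∷ (50 , 52 , 55) ∷
  (51 , 53 , 55) ∷ (52 , 54 , 56) ∷ (37 , 53 , 56) ∷ (51 , 52 , 60) ∷ (53 , 54 , 58) ∷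
  (43 , 58 , 59) ∷ (56 , 57 , 59) ∷ (57 , 58 , 63) ∷ (55 , 61 , 62) ∷ (31 , 60 , 62) ∷
  (60 , 61 , 75) ∷ (59 , 64 , 68) ∷ (63 , 65 , 68) ∷ (64 , 66 , 67) ∷ (30 , 65 , 67) ∷
  (65 , 66 , 76) ∷ (63 , 64 , 70) ∷ (18 , 70 , 71) ∷ (68 , 69 , 71) ∷ (69 , 70 , 73) ∷
  (38 , 73 , 74) ∷ (71 , 72 , 74) ∷ (72 , 73 , 79) ∷ (62 , 76 , 77) ∷ (67 , 75 , 77) ∷
  (75 , 76 , 81) ∷ (49 , 79 , 80) ∷ (74 , 78 , 80) ∷ (78 , 79 , 82) ∷ (77 , 82 , 83) ∷
  (80 , 81 , 83) ∷ (19 , 81 , 82) ∷ []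

T8 : Table
T8 =
  (1 , 3 , 9) ∷ (0 , 2 , 53) ∷ (1 , 3 , 4) ∷ (0 , 2 , 60) ∷ (2 , 5 , 11) ∷ (4 , 6 , 66) ∷
  (5 , 7 , 11) ∷ (6 , 8 , 10) ∷ (7 , 9 , 17) ∷ (0 , 8 , 10) ∷ (7 , 9 , 12) ∷ (4 , 6 , 31) ∷
  (10 , 13 , 19) ∷ (12 , 14 , 20) ∷ (13 , 15 , 19) ∷ (14 , 16 , 18) ∷ (15 , 17 , 72) ∷
  (8 , 16 , 18) ∷ (15 , 17 , 40) ∷ (12 , 14 , 25) ∷ (13 , 21 , 26) ∷ (20 , 22 , 58) ∷
  (21 , 23 , 26) ∷ (22 , 24 , 27) ∷ (23 , 25 , 48) ∷ (19 , 24 , 27) ∷ (20 , 22 , 28) ∷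
  (23 , 25 , 69) ∷ (26 , 29 , 32) ∷ (28 , 30 , 33) ∷ (29 , 31 , 35) ∷ (11 , 30 , 34) ∷
  (28 , 33 , 36) ∷ (29 , 32 , 56) ∷ (31 , 35 , 38) ∷ (30 , 34 , 64) ∷ (32 , 37 , 39) ∷
  (36 , 38 , 44) ∷ (34 , 37 , 39) ∷ (36 , 38 , 41) ∷ (18 , 41 , 43) ∷ (39 , 40 , 42) ∷
  (41 , 43 , 74) ∷ (40 , 42 , 46) ∷ (37 , 45 , 47) ∷ (44 , 46 , 49) ∷ (43 , 45 , 47) ∷
  (44 , 46 , 52) ∷ (24 , 49 , 50) ∷ (45 , 48 , 51) ∷ (48 , 51 , 54) ∷ (49 , 50 , 70) ∷
  (47 , 53 , 55) ∷ (1 , 52 , 54) ∷ (50 , 53 , 55) ∷ (52 , 54 , 62) ∷ (33 , 57 , 59) ∷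
  (56 , 58 , 76) ∷ (21 , 57 , 59) ∷ (56 , 58 , 61) ∷ (3 , 61 , 63) ∷ (59 , 60 , 62) ∷
  (55 , 61 , 63) ∷ (60 , 62 , 78) ∷ (35 , 65 , 67) ∷ (64 , 66 , 68) ∷ (5 , 65 , 67) ∷
  (64 , 66 , 83) ∷ (65 , 69 , 70) ∷ (27 , 68 , 71) ∷ (51 , 68 , 71) ∷ (69 , 70 , 80) ∷
  (16 , 73 , 75) ∷ (72 , 74 , 77) ∷ (42 , 73 , 75) ∷ (72 , 74 , 81) ∷ (57 , 77 , 79) ∷
  (73 , 76 , 78) ∷ (63 , 77 , 79) ∷ (76 , 78 , 82) ∷ (71 , 81 , 82) ∷ (75 , 80 , 83) ∷
  (79 , 80 , 83) ∷ (67 , 81 , 82) ∷ []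

-- Spanning trees of coset representatives, by parent and step

tree0 : List (ℕ × ℕ)
tree0 =
  (0 , 1) ∷ (1 , 0) ∷ (2 , 0) ∷ (0 , 0) ∷ (0 , 2) ∷ (5 , 0) ∷ (6 , 2) ∷ (7 , 1) ∷ (8 , 2) ∷
  (4 , 2) ∷ (9 , 0) ∷ (11 , 0) ∷ (10 , 0) ∷ (5 , 1) ∷ (14 , 0) ∷ (6 , 0) ∷ (14 , 2) ∷
  (17 , 1) ∷ (11 , 2) ∷ (18 , 2) ∷ (1 , 2) ∷ (8 , 0) ∷ (20 , 0) ∷ (21 , 0) ∷ (23 , 0) ∷
  (22 , 0) ∷ (7 , 0) ∷ (17 , 0) ∷ (19 , 0) ∷ (29 , 2) ∷ (30 , 1) ∷ (26 , 2) ∷ (25 , 2) ∷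
  (31 , 2) ∷ (12 , 2) ∷ (30 , 0) ∷ (32 , 0) ∷ (16 , 2) ∷ (36 , 2) ∷ (37 , 2) ∷ (15 , 2) ∷
  (13 , 2) ∷ (38 , 1) ∷ (39 , 1) ∷ (27 , 2) ∷ (43 , 2) ∷ (3 , 2) ∷ (44 , 2) ∷ (28 , 2) ∷
  (49 , 1) ∷ (41 , 1) ∷ (2 , 2) ∷ (24 , 2) ∷ (40 , 1) ∷ (45 , 0) ∷ (47 , 1) ∷ (33 , 0) ∷
  (48 , 0) ∷ (35 , 0) ∷ []

tree1 : List (ℕ × ℕ)
tree1 =
  (0 , 0) ∷ (1 , 3) ∷ (2 , 0) ∷ (3 , 2) ∷ (0 , 3) ∷ (5 , 3) ∷ (6 , 0) ∷ (7 , 2) ∷ (4 , 3) ∷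
  (6 , 3) ∷ (10 , 0) ∷ (11 , 2) ∷ (7 , 3) ∷ (2 , 3) ∷ (12 , 3) ∷ (14 , 3) ∷ (13 , 3) ∷
  (3 , 3) ∷ (15 , 3) ∷ (19 , 3) ∷ (20 , 0) ∷ (21 , 2) ∷ (18 , 3) ∷ (0 , 2) ∷ (21 , 3) ∷
  (22 , 3) ∷ (17 , 3) ∷ (26 , 3) ∷ (16 , 3) ∷ (24 , 3) ∷ (20 , 3) ∷ (27 , 3) ∷ (23 , 3) ∷
  (30 , 3) ∷ (32 , 3) ∷ (35 , 3) ∷ (31 , 3) ∷ (36 , 3) ∷ (8 , 3) ∷ (28 , 3) ∷ (10 , 3) ∷
  (25 , 3) ∷ (1 , 2) ∷ (39 , 0) ∷ (38 , 0) ∷ (33 , 3) ∷ (34 , 3) ∷ (41 , 3) ∷ (29 , 3) ∷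
  (49 , 3) ∷ (46 , 3) ∷ (45 , 2) ∷ (37 , 3) ∷ (53 , 3) ∷ (51 , 3) ∷ (11 , 3) ∷ (9 , 3) ∷
  (44 , 2) ∷ (40 , 3) ∷ []

tree2 : List (ℕ × ℕ)
tree2 =
  (0 , 1) ∷ (1 , 0) ∷ (2 , 0) ∷ (0 , 0) ∷ (0 , 2) ∷ (5 , 0) ∷ (6 , 2) ∷ (7 , 0) ∷ (8 , 0) ∷
  (9 , 2) ∷ (2 , 2) ∷ (9 , 0) ∷ (7 , 1) ∷ (11 , 1) ∷ (14 , 0) ∷ (10 , 1) ∷ (13 , 2) ∷
  (17 , 1) ∷ (3 , 2) ∷ (17 , 0) ∷ (19 , 0) ∷ (20 , 2) ∷ (15 , 2) ∷ (18 , 2) ∷ (24 , 0) ∷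
  (16 , 2) ∷ (24 , 1) ∷ (26 , 1) ∷ (5 , 1) ∷ (29 , 0) ∷ (6 , 0) ∷ (14 , 2) ∷ (31 , 2) ∷
  (30 , 2) ∷ (21 , 2) ∷ (22 , 0) ∷ (36 , 2) ∷ (1 , 2) ∷ (23 , 1) ∷ (36 , 0) ∷ (38 , 1) ∷
  (25 , 2) ∷ (37 , 0) ∷ (33 , 0) ∷ (8 , 2) ∷ (40 , 2) ∷ (27 , 2) ∷ (34 , 0) ∷ (41 , 2) ∷
  (35 , 0) ∷ (45 , 1) ∷ (47 , 0) ∷ (32 , 0) ∷ (44 , 0) ∷ (12 , 2) ∷ (54 , 2) ∷ (4 , 2) ∷
  (39 , 2) ∷ (48 , 2) ∷ []

tree3 : List (ℕ × ℕ)
tree3 =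
  (0 , 2) ∷ (1 , 1) ∷ (2 , 2) ∷ (3 , 0) ∷ (4 , 2) ∷ (5 , 1) ∷ (6 , 0) ∷ (0 , 1) ∷ (2 , 0) ∷
  (9 , 2) ∷ (10 , 1) ∷ (7 , 2) ∷ (3 , 1) ∷ (13 , 2) ∷ (12 , 1) ∷ (5 , 0) ∷ (16 , 2) ∷
  (17 , 1) ∷ (9 , 0) ∷ (8 , 2) ∷ (18 , 2) ∷ (14 , 0) ∷ (22 , 2) ∷ (17 , 0) ∷ (1 , 0) ∷
  (23 , 1) ∷ (26 , 2) ∷ (11 , 2) ∷ (27 , 1) ∷ (21 , 1) ∷ (15 , 2) ∷ (30 , 0) ∷ (6 , 2) ∷
  (29 , 0) ∷ (33 , 1) ∷ (22 , 0) ∷ (19 , 2) ∷ (34 , 2) ∷ (13 , 0) ∷ (16 , 0) ∷ (31 , 0) ∷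
  (25 , 2) ∷ (39 , 2) ∷ (20 , 1) ∷ (42 , 1) ∷ (37 , 1) ∷ (44 , 2) ∷ (36 , 0) ∷ (40 , 0) ∷
  (10 , 0) ∷ (4 , 0) ∷ (46 , 0) ∷ (28 , 1) ∷ (49 , 0) ∷ (0 , 0) ∷ (38 , 1) ∷ (24 , 2) ∷
  (50 , 2) ∷ (32 , 2) ∷ []

tree4 : List (ℕ × ℕ)
tree4 =
  (0 , 0) ∷ (0 , 2) ∷ (0 , 4) ∷ (3 , 0) ∷ (4 , 4) ∷ (5 , 2) ∷ (6 , 4) ∷ (7 , 2) ∷ (8 , 4) ∷
  (9 , 2) ∷ (10 , 4) ∷ (2 , 4) ∷ (11 , 0) ∷ (9 , 0) ∷ (7 , 0) ∷ (5 , 0) ∷ (3 , 2) ∷ (13 , 4) ∷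
  (18 , 2) ∷ (19 , 4) ∷ (20 , 2) ∷ (21 , 4) ∷ (15 , 4) ∷ (22 , 0) ∷ (18 , 0) ∷ (20 , 0) ∷
  (17 , 4) ∷ (26 , 4) ∷ (27 , 0) ∷ (25 , 4) ∷ (30 , 2) ∷ (31 , 4) ∷ (32 , 2) ∷ (33 , 4) ∷
  (14 , 4) ∷ (34 , 0) ∷ (32 , 0) ∷ (30 , 0) ∷ (37 , 4) ∷ (24 , 4) ∷ (39 , 0) ∷ (38 , 4) ∷
  (42 , 2) ∷ (43 , 4) ∷ (1 , 4) ∷ (42 , 0) ∷ (44 , 0) ∷ (29 , 4) ∷ (46 , 4) ∷ (48 , 0) ∷
  (47 , 4) ∷ (36 , 4) ∷ (51 , 0) ∷ (41 , 4) ∷ (50 , 4) ∷ (54 , 0) ∷ (53 , 4) ∷ (56 , 4) ∷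
  (16 , 4) ∷ []

tree5 : List (ℕ × ℕ)
tree5 =
  (0 , 0) ∷ (1 , 1) ∷ (2 , 1) ∷ (3 , 1) ∷ (0 , 1) ∷ (0 , 4) ∷ (6 , 0) ∷ (7 , 1) ∷ (3 , 4) ∷
  (6 , 1) ∷ (9 , 0) ∷ (7 , 4) ∷ (12 , 0) ∷ (13 , 1) ∷ (11 , 4) ∷ (12 , 1) ∷ (15 , 1) ∷
  (1 , 4) ∷ (18 , 0) ∷ (19 , 1) ∷ (4 , 4) ∷ (13 , 4) ∷ (20 , 4) ∷ (17 , 4) ∷ (23 , 1) ∷
  (21 , 0) ∷ (18 , 1) ∷ (24 , 0) ∷ (22 , 1) ∷ (14 , 4) ∷ (30 , 1) ∷ (31 , 1) ∷ (16 , 4) ∷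
  (32 , 4) ∷ (2 , 4) ∷ (34 , 0) ∷ (5 , 4) ∷ (36 , 4) ∷ (29 , 4) ∷ (26 , 4) ∷ (31 , 4) ∷
  (38 , 0) ∷ (25 , 4) ∷ (19 , 4) ∷ (41 , 1) ∷ (37 , 1) ∷ (35 , 0) ∷ (30 , 0) ∷ (43 , 1) ∷
  (39 , 0) ∷ (33 , 1) ∷ (44 , 1) ∷ (40 , 0) ∷ (50 , 4) ∷ (10 , 4) ∷ (53 , 4) ∷ (45 , 4) ∷
  (42 , 4) ∷ (8 , 4) ∷ []

tree6 : List (ℕ × ℕ)
tree6 =
  (0 , 1) ∷ (1 , 1) ∷ (2 , 1) ∷ (3 , 1) ∷ (0 , 0) ∷ (0 , 4) ∷ (6 , 0) ∷ (7 , 1) ∷ (3 , 4) ∷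
  (6 , 1) ∷ (9 , 0) ∷ (7 , 4) ∷ (12 , 0) ∷ (13 , 1) ∷ (11 , 4) ∷ (12 , 1) ∷ (15 , 0) ∷
  (1 , 4) ∷ (18 , 0) ∷ (19 , 1) ∷ (4 , 4) ∷ (17 , 4) ∷ (20 , 4) ∷ (13 , 4) ∷ (23 , 0) ∷
  (21 , 0) ∷ (18 , 1) ∷ (24 , 1) ∷ (22 , 0) ∷ (14 , 4) ∷ (30 , 0) ∷ (31 , 1) ∷ (16 , 4) ∷
  (32 , 4) ∷ (5 , 4) ∷ (34 , 1) ∷ (2 , 4) ∷ (36 , 4) ∷ (29 , 4) ∷ (26 , 4) ∷ (31 , 4) ∷
  (38 , 1) ∷ (25 , 4) ∷ (19 , 4) ∷ (41 , 0) ∷ (37 , 1) ∷ (35 , 0) ∷ (30 , 1) ∷ (43 , 0) ∷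
  (39 , 1) ∷ (33 , 0) ∷ (44 , 0) ∷ (40 , 1) ∷ (50 , 4) ∷ (10 , 4) ∷ (53 , 4) ∷ (45 , 4) ∷
  (8 , 4) ∷ (42 , 4) ∷ []

tree7 : List (ℕ × ℕ)
tree7 =
  (0 , 1) ∷ (0 , 0) ∷ (0 , 4) ∷ (3 , 0) ∷ (4 , 4) ∷ (5 , 1) ∷ (6 , 4) ∷ (7 , 0) ∷ (8 , 4) ∷
  (9 , 0) ∷ (10 , 4) ∷ (11 , 0) ∷ (12 , 4) ∷ (2 , 4) ∷ (9 , 1) ∷ (3 , 1) ∷ (7 , 1) ∷ (5 , 0) ∷
  (13 , 1) ∷ (11 , 1) ∷ (16 , 4) ∷ (21 , 0) ∷ (22 , 4) ∷ (23 , 0) ∷ (24 , 4) ∷ (25 , 1) ∷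
  (26 , 4) ∷ (15 , 4) ∷ (23 , 1) ∷ (27 , 0) ∷ (21 , 1) ∷ (25 , 0) ∷ (29 , 4) ∷ (33 , 1) ∷
  (34 , 4) ∷ (20 , 4) ∷ (35 , 0) ∷ (33 , 0) ∷ (1 , 4) ∷ (39 , 1) ∷ (40 , 4) ∷ (32 , 4) ∷
  (39 , 0) ∷ (41 , 1) ∷ (44 , 4) ∷ (45 , 1) ∷ (46 , 4) ∷ (17 , 4) ∷ (45 , 0) ∷ (47 , 0) ∷
  (50 , 4) ∷ (51 , 0) ∷ (52 , 4) ∷ (37 , 4) ∷ (51 , 1) ∷ (53 , 0) ∷ (43 , 4) ∷ (56 , 4) ∷
  (57 , 0) ∷ (55 , 4) ∷ (31 , 4) ∷ (60 , 0) ∷ (59 , 4) ∷ (63 , 1) ∷ (64 , 4) ∷ (30 , 4) ∷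
  (65 , 1) ∷ (63 , 0) ∷ (18 , 4) ∷ (68 , 4) ∷ (69 , 1) ∷ (38 , 4) ∷ (71 , 4) ∷ (72 , 1) ∷
  (62 , 4) ∷ (67 , 4) ∷ (75 , 0) ∷ (49 , 4) ∷ (74 , 4) ∷ (78 , 0) ∷ (77 , 4) ∷ (80 , 4) ∷
  (19 , 4) ∷ []

tree8 : List (ℕ × ℕ)
tree8 =
  (0 , 0) ∷ (1 , 0) ∷ (0 , 1) ∷ (2 , 4) ∷ (4 , 1) ∷ (5 , 0) ∷ (6 , 4) ∷ (7 , 1) ∷ (0 , 4) ∷
  (7 , 0) ∷ (4 , 0) ∷ (10 , 4) ∷ (12 , 1) ∷ (13 , 0) ∷ (14 , 4) ∷ (15 , 1) ∷ (8 , 4) ∷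
  (15 , 0) ∷ (12 , 0) ∷ (13 , 4) ∷ (20 , 1) ∷ (21 , 0) ∷ (22 , 4) ∷ (23 , 0) ∷ (19 , 4) ∷
  (20 , 0) ∷ (23 , 1) ∷ (26 , 4) ∷ (28 , 0) ∷ (29 , 4) ∷ (11 , 4) ∷ (28 , 1) ∷ (29 , 0) ∷
  (31 , 0) ∷ (30 , 1) ∷ (32 , 4) ∷ (36 , 1) ∷ (34 , 4) ∷ (36 , 0) ∷ (18 , 4) ∷ (39 , 4) ∷
  (41 , 1) ∷ (40 , 1) ∷ (37 , 4) ∷ (44 , 0) ∷ (43 , 4) ∷ (44 , 1) ∷ (24 , 4) ∷ (45 , 4) ∷
  (48 , 0) ∷ (49 , 1) ∷ (47 , 4) ∷ (1 , 4) ∷ (50 , 4) ∷ (52 , 0) ∷ (33 , 4) ∷ (56 , 1) ∷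
  (21 , 4) ∷ (56 , 0) ∷ (3 , 4) ∷ (59 , 4) ∷ (55 , 4) ∷ (60 , 0) ∷ (35 , 4) ∷ (64 , 0) ∷
  (5 , 4) ∷ (64 , 1) ∷ (65 , 4) ∷ (27 , 4) ∷ (51 , 4) ∷ (69 , 0) ∷ (16 , 4) ∷ (72 , 0) ∷
  (42 , 4) ∷ (72 , 1) ∷ (57 , 4) ∷ (73 , 4) ∷ (63 , 4) ∷ (76 , 0) ∷ (71 , 4) ∷ (75 , 4) ∷
  (79 , 4) ∷ (67 , 4) ∷ []

-- The nine graphs and their certificates

module Graph0 where

  h a b : Perm 5
  h = cyc ((1 ∷ 3 ∷ []) ∷ (2 ∷ 5 ∷ []) ∷ [])
  a = cyc ((1 ∷ 2 ∷ 4 ∷ 5 ∷ 3 ∷ []) ∷ [])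
  b = cyc ((2 ∷ 5 ∷ []) ∷ [])

  open CosetTable (h ∷ []) a b tree0 T0
  open Sym₅ (h ∷ []) a b tree0 T0

  facts : Facts NC0-60 T0
  -- Here `c` is 12, and the neighbours 5 and 1 of vertex 0 lie in different orbits of its
  -- stabiliser. The pairs address the five commutators through `elements`. The other graphs follow
  -- the same pattern.
  facts = symFacts refl refl 12 5 1
    ((0 , 7) ∷ (0 , 19) ∷ (0 , 39) ∷ (1 , 2) ∷ (1 , 3) ∷ []) refl refl

module Graph1 where

  h a b : Perm 7
  h = cyc ((2 ∷ 3 ∷ []) ∷ (4 ∷ 5 ∷ []) ∷ [])
  a = cyc ((2 ∷ 5 ∷ []) ∷ (3 ∷ 4 ∷ []) ∷ (6 ∷ 7 ∷ []) ∷ [])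
  b = cyc ((1 ∷ 2 ∷ []) ∷ (3 ∷ 4 ∷ []) ∷ (6 ∷ 7 ∷ []) ∷ [])

  open CosetTable (h ∷ []) a b tree1 T1
  open ProductWithZ₂ alternating (h ∷ []) a b tree1 T1

  facts : Facts NC1-60 T1
  facts = productFacts refl refl 49 1 5
    ((0 , 4) ∷ (0 , 6) ∷ (1 , 8) ∷ (1 , 20) ∷ (1 , 43) ∷ []) refl refl

module Graph2 where

  h a b : Perm 7
  h = cyc ((2 ∷ 3 ∷ []) ∷ (4 ∷ 5 ∷ []) ∷ [])
  a = cyc ((1 ∷ 2 ∷ 4 ∷ 5 ∷ 3 ∷ []) ∷ [])
  b = cyc ((2 ∷ 4 ∷ []) ∷ (3 ∷ 5 ∷ []) ∷ (6 ∷ 7 ∷ []) ∷ [])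

  open CosetTable (h ∷ []) a b tree2 T2
  open ProductWithZ₂ alternating (h ∷ []) a b tree2 T2

  facts : Facts NC2-60 T2
  facts = productFacts refl refl 40 5 1
    ((1 , 2) ∷ (1 , 3) ∷ (1 , 8) ∷ (1 , 34) ∷ (1 , 49) ∷ []) refl refl

module Graph3 where

  h a b : Perm 7
  h = cyc ((2 ∷ 3 ∷ []) ∷ (4 ∷ 5 ∷ []) ∷ [])
  a = cyc ((1 ∷ 3 ∷ 5 ∷ 4 ∷ 2 ∷ []) ∷ (6 ∷ 7 ∷ []) ∷ [])
  b = cyc ((2 ∷ 4 ∷ []) ∷ (3 ∷ 5 ∷ []) ∷ [])

  open CosetTable (h ∷ []) a b tree3 T3
  open ProductWithZ₂ alternating (h ∷ []) a b tree3 T3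

  facts : Facts NC3-60 T3
  facts = productFacts refl refl 1 1 8
    ((0 , 9) ∷ (0 , 21) ∷ (1 , 4) ∷ (1 , 5) ∷ (1 , 26) ∷ []) refl refl

module Graph4 where

  h₁ h₂ a b : Perm 7
  h₁ = cyc ((1 ∷ 3 ∷ []) ∷ [])
  h₂ = cyc ((4 ∷ 5 ∷ []) ∷ [])
  a = cyc ((1 ∷ 3 ∷ 2 ∷ []) ∷ (4 ∷ 5 ∷ []) ∷ [])
  b = cyc ((1 ∷ 5 ∷ 3 ∷ 4 ∷ []) ∷ (6 ∷ 7 ∷ []) ∷ [])

  open CosetTable (h₁ ∷ h₂ ∷ []) a b tree4 T4
  open ProductWithZ₂ symmetric (h₁ ∷ h₂ ∷ []) a b tree4 T4

  facts : Facts NC4-60 T4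
  facts = productFacts refl refl 37 3 1
    ((0 , 14) ∷ (1 , 1) ∷ (2 , 9) ∷ (3 , 2) ∷ (3 , 23) ∷ []) refl refl

module Graph5 where

  h₁ h₂ a b : Perm 7
  h₁ = cyc ((1 ∷ 3 ∷ []) ∷ (6 ∷ 7 ∷ []) ∷ [])
  h₂ = cyc ((4 ∷ 5 ∷ []) ∷ (6 ∷ 7 ∷ []) ∷ [])
  a = cyc ((2 ∷ 5 ∷ []) ∷ [])
  b = cyc ((1 ∷ 4 ∷ 3 ∷ 5 ∷ []) ∷ (6 ∷ 7 ∷ []) ∷ [])

  open CosetTable (h₁ ∷ h₂ ∷ []) a b tree5 T5
  open ProductWithZ₂ symmetric (h₁ ∷ h₂ ∷ []) a b tree5 T5

  facts : Facts NC5-60 T5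
  facts = productFacts refl refl 6 6 1
    ((0 , 54) ∷ (0 , 56) ∷ (1 , 2) ∷ (1 , 4) ∷ (3 , 21) ∷ []) refl refl

module Graph6 where

  h₁ h₂ a b : Perm 7
  h₁ = cyc ((1 ∷ 3 ∷ []) ∷ (6 ∷ 7 ∷ []) ∷ [])
  h₂ = cyc ((4 ∷ 5 ∷ []) ∷ (6 ∷ 7 ∷ []) ∷ [])
  a = cyc ((2 ∷ 4 ∷ []) ∷ [])
  b = cyc ((1 ∷ 4 ∷ []) ∷ (3 ∷ 5 ∷ []) ∷ (6 ∷ 7 ∷ []) ∷ [])

  open CosetTable (h₁ ∷ h₂ ∷ []) a b tree6 T6
  open ProductWithZ₂ symmetric (h₁ ∷ h₂ ∷ []) a b tree6 T6

  facts : Facts NC6-60 T6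
  facts = productFacts refl refl 9 6 1
    ((0 , 2) ∷ (0 , 4) ∷ (0 , 18) ∷ (0 , 57) ∷ (2 , 54) ∷ []) refl refl

module Graph7 where

  h₁ h₂ a b : Perm 8
  h₁ = cyc ((1 ∷ 7 ∷ []) ∷ (2 ∷ 4 ∷ []) ∷ (3 ∷ 8 ∷ []) ∷ [])
  h₂ = cyc ((1 ∷ 4 ∷ []) ∷ (2 ∷ 7 ∷ []) ∷ (5 ∷ 6 ∷ []) ∷ [])
  a = cyc ((1 ∷ 8 ∷ 4 ∷ []) ∷ (2 ∷ 7 ∷ 3 ∷ []) ∷ [])
  b = cyc ((1 ∷ 4 ∷ 2 ∷ 7 ∷ []) ∷ (3 ∷ 6 ∷ 8 ∷ 5 ∷ []) ∷ [])

  open CosetTable (h₁ ∷ h₂ ∷ []) a b tree7 T7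

  facts : Facts NC7-84 T7
  -- This `G` is generated by `h₁`, `h₂`, `a`, `b` by definition, so both inclusions are `id`.
  facts = Cosets.CosetGraph.facts refl id id 3 3 1
    ((0 , 3) ∷ (0 , 15) ∷ (0 , 50) ∷ (2 , 7) ∷ (3 , 3) ∷ []) refl refl

module Graph8 where

  h₁ h₂ a b : Perm 8
  h₁ = cyc ((1 ∷ 6 ∷ []) ∷ (2 ∷ 4 ∷ []) ∷ (3 ∷ 7 ∷ []) ∷ (5 ∷ 8 ∷ []) ∷ [])
  h₂ = cyc ((1 ∷ 4 ∷ []) ∷ (2 ∷ 6 ∷ []) ∷ (3 ∷ 8 ∷ []) ∷ (5 ∷ 7 ∷ []) ∷ [])
  a = cyc ((1 ∷ 3 ∷ 5 ∷ 2 ∷ 6 ∷ 7 ∷ 8 ∷ 4 ∷ []) ∷ [])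
  b = cyc ((1 ∷ 5 ∷ 2 ∷ 3 ∷ []) ∷ (4 ∷ 8 ∷ 6 ∷ 7 ∷ []) ∷ [])

  open CosetTable (h₁ ∷ h₂ ∷ []) a b tree8 T8

  facts : Facts NC8-84 T8
  facts = Cosets.CosetGraph.facts refl id id 2 9 1
    ((0 , 2) ∷ (0 , 50) ∷ (1 , 30) ∷ (2 , 2) ∷ (2 , 72) ∷ []) refl refl

tables : Vec Table 9
tables = T0 ∷ᵛ T1 ∷ᵛ T2 ∷ᵛ T3 ∷ᵛ T4 ∷ᵛ T5 ∷ᵛ T6 ∷ᵛ T7 ∷ᵛ T8 ∷ᵛ []ᵛ

-- Asking for embeddings treats pairs of unequal size in the same way: with `i` below `j`, a graph
-- on 60 vertices is searched for inside one on 84.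
noEmbeddings : ∀ (i j : Fin 9) → i F< j → searchFrom (lookup tables i) (lookup tables j) 0 ≡ []
noEmbeddings = decided
  (F.all? λ i → F.all? λ j →
    (i F<? j) →-dec isEmpty? (searchFrom (lookup tables i) (lookup tables j) 0)) refl
  where
  isEmpty? : ∀ (xs : List (List ℕ)) → Dec (xs ≡ [])
  isEmpty? []      = yes refl
  isEmpty? (_ ∷ _) = no λ ()

ncFacts : ∀ i → Facts (NC i) (lookup tables i)
ncFacts zero = Graph0.facts
ncFacts (suc zero) = Graph1.facts
ncFacts (suc (suc zero)) = Graph2.facts
ncFacts (suc (suc (suc zero))) = Graph3.facts
ncFacts (suc (suc (suc (suc zero)))) = Graph4.facts
ncFacts (suc (suc (suc (suc (suc zero))))) = Graph5.facts
ncFacts (suc (suc (suc (suc (suc (suc zero)))))) = Graph6.facts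
ncFacts (suc (suc (suc (suc (suc (suc (suc zero))))))) = Graph7.facts
ncFacts (suc (suc (suc (suc (suc (suc (suc (suc zero)))))))) = Graph8.facts

theorem5p2 : (∀ (i j : Fin 9) → i ≢ j → ¬ Iso (NC i) (NC j)) ×
    (∀ (i : Fin 9) →
    Connected (NC i) × Cubic (NC i) × VertexTransitive (NC i) ×
    ¬ Symmetric (NC i) × ¬ Cayley (NC i) × ¬ SolvableAut (NC i))
theorem5p2 = pairwiseNonIsomorphic ncFacts noEmbeddings , allProperties ncFacts noEmbeddings
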